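{- The Erdős–Hajnal coefficient of the directed path $P_k$ satisfies $$\epsilon(P_k)=\frac{1}{k^{1+o(1)}}\qquad\text{as } k\to\infty.$$
   Context: All graphs are finite and simple. A tournament is a directed graph in which for every two distinct vertices $u,v$ exactly one of $(u,v),(v,u)$ is an edge. A tournament is transitive if it contains no directed cycle. A tournament $T$ is $H$-free if it has no induced subtournament isomorphic to $H$. The directed path $P_k$ is the tournament with vertex set $\{v_1,\dots,v_k\}$ in which, for $1\le i<j\le k$, the edge between $v_i$ and $v_j$ is $(v_j,v_i)$ if $j=i+1$ and $(v_i,v_j)$ otherwise. For a tournament $H$, the Erdős–Hajnal coefficient $\epsilon(H)$ is the supremum of all $\epsilon\ge 0$ such that every $H$-free tournament $T$ (with at least one vertex) contains a transitive subtournament of order at least $|T|^{\epsilon}$, where $|T|$ is the number of vertices of $T$. -}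

module Defs where

open import Algebra.Definitions.RawSemiring using () renaming (_^_ to pow)
open import Data.Fin.Base using (Fin; zero; suc; toℕ; fromℕ; inject₁)
open import Data.Fin.Properties using (toℕ-injective)
open import Data.Integer.Base using (ℤ; +_; -[1+_]; ∣_∣)
open import Data.Nat.Base as ℕ using (ℕ; zero; suc; NonZero)
import Data.Nat.Properties as ℕ
open import Data.Product.Base using (Σ; ∃; ∃-syntax; _×_; _,_)
open import Data.Rational.Base
  using (ℚ; 0ℚ; 1ℚ; _+_; _-_; _*_; -_; _≤_; _<_; _/_; ↥_; ↧ₙ_; +-*-rawSemiring)
open import Data.Sum.Base using (_⊎_; inj₁; inj₂)
open import Function.Bundles using (_↣_; _⤖_; _⇔_; Injection; Bijection)
open import Level using (Level; 0ℓ) renaming (suc to lsuc)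
open import Relation.Binary.Core using (Rel)
open import Relation.Binary.Definitions using (tri<; tri≈; tri>)
open import Relation.Binary.PropositionalEquality.Core
  using (_≡_; _≢_; refl; sym)
open import Relation.Nullary.Decidable.Core using (yes; no)
open import Relation.Nullary.Negation.Core using (¬_; contradiction)
open import Relation.Unary using (Pred; _⊆_)

------------------------------------------------------------------------
-- Tournaments

record Tournament (n : ℕ) : Set₁ where
  infix 4 _⟶_
  field
    _⟶_        : Rel (Fin n) 0ℓ
    loopless   : ∀ u → ¬ (u ⟶ u)
    exactlyOne : ∀ {u v} → u ≢ v →
                 ((u ⟶ v) × ¬ (v ⟶ u)) ⊎ (¬ (u ⟶ v) × (v ⟶ u))

open Tournament using (loopless; exactlyOne)

-- The subtournament induced on an m-element set of vertices, the set being
-- given by an injective enumeration.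
_[_] : ∀ {m n} → Tournament n → (Fin m ↣ Fin n) → Tournament m
T [ f ] = record
  { _⟶_        = λ u v → Tournament._⟶_ T (to u) (to v)
  ; loopless   = λ u → loopless T (to u)
  ; exactlyOne = λ u≢v → exactlyOne T (λ eq → u≢v (injective eq))
  }
  where open Injection f using (to; injective)

record _≅_ {m n} (S : Tournament m) (T : Tournament n) : Set where
  field
    bijection : Fin m ⤖ Fin n
  open Bijection bijection using (to)
  field
    edges : ∀ u v → Tournament._⟶_ S u v ⇔ Tournament._⟶_ T (to u) (to v)

_-Free : ∀ {h n} → Tournament h → Tournament n → Set
_-Free {n = n} H T = ¬ (∃[ m ] Σ (Fin m ↣ Fin n) λ f → (T [ f ]) ≅ H)

-- A cycle on ℓ + 1 distinct vertices.
record DirectedCycle {n} (T : Tournament n) : Set where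
  open Tournament T using (_⟶_)
  field
    ℓ        : ℕ
    vertices : Fin (suc ℓ) ↣ Fin n
  open Injection vertices using (to)
  field
    step  : ∀ (i : Fin ℓ) → to (inject₁ i) ⟶ to (suc i)
    close : to (fromℕ ℓ) ⟶ to zero

Transitive : ∀ {n} → Tournament n → Set
Transitive T = ¬ DirectedCycle T

-- The vertex v_{i+1} is represented by i : Fin k.
P : (k : ℕ) → Tournament k
P k = record
  { _⟶_        = _⟶_
  ; loopless   = λ { u (inj₁ eq) → ℕ.1+n≢n (sym eq)
                   ; u (inj₂ (u<u , _)) → ℕ.<-irrefl refl u<u }
  ; exactlyOne = one
  }
  where
  _⟶_ : Rel (Fin k) 0ℓ
  u ⟶ v = toℕ u ≡ suc (toℕ v)
        ⊎ (toℕ u ℕ.< toℕ v × toℕ v ≢ suc (toℕ u))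

  forward : ∀ {u v} → toℕ u ℕ.< toℕ v →
            ((u ⟶ v) × ¬ (v ⟶ u)) ⊎ (¬ (u ⟶ v) × (v ⟶ u))
  forward {u} {v} u<v with toℕ v ℕ.≟ suc (toℕ u)
  ... | yes eq = inj₂ ( (λ { (inj₁ eq′) → ℕ.<-asym u<v (ℕ.≤-reflexive (sym eq′))
                           ; (inj₂ (_ , neq)) → neq eq })
                      , inj₁ eq )
  ... | no neq = inj₁ ( inj₂ (u<v , neq)
                      , (λ { (inj₁ eq) → neq eq
                           ; (inj₂ (v<u , _)) → ℕ.<-asym u<v v<u }) )

  one : ∀ {u v} → u ≢ v → ((u ⟶ v) × ¬ (v ⟶ u)) ⊎ (¬ (u ⟶ v) × (v ⟶ u))
  one {u} {v} u≢v with ℕ.<-cmp (toℕ u) (toℕ v)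
  ... | tri< u<v _ _ = forward u<v
  ... | tri≈ _ eq _  = contradiction (toℕ-injective eq) u≢v
  ... | tri> _ _ v<u with forward {v} {u} v<u
  ...   | inj₁ (v⟶u , ¬u⟶v) = inj₂ (¬u⟶v , v⟶u)
  ...   | inj₂ (¬v⟶u , u⟶v) = inj₁ (u⟶v , ¬v⟶u)

------------------------------------------------------------------------
-- Real numbers (Dedekind cuts)

record ℝ : Set₁ where
  field
    lower upper   : Pred ℚ 0ℓ
    lower-inhab   : ∃ lower
    upper-inhab   : ∃ upper
    lower-closed  : ∀ {p q} → p < q → lower q → lower p
    upper-closed  : ∀ {p q} → p < q → upper p → upper q
    lower-rounded : ∀ {p} → lower p → ∃[ q ] p < q × lower q
    upper-rounded : ∀ {q} → upper q → ∃[ p ] p < q × upper p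
    disjoint      : ∀ {q} → ¬ (lower q × upper q)
    located       : ∀ {p q} → p < q → lower p ⊎ upper q

_<ᴿ_ : ℚ → ℝ → Set
q <ᴿ x = ℝ.lower x q

_≤ᴿ_ : ℚ → ℝ → Set
q ≤ᴿ x = ¬ ℝ.upper x q

-- n ^ ε ≤ m for ε ≥ 0 and n ≥ 1, the real power being
-- sup { n ^ (a / b) | 0 ≤ a / b ≤ ε }, and n ^ (a / b) ≤ m being n ^ a ≤ m ^ b.
_^_≤ₙ_ : ℕ → ℝ → ℕ → Set
n ^ ε ≤ₙ m = ∀ q → 0ℚ ≤ q → q ≤ᴿ ε → n ℕ.^ ∣ ↥ q ∣ ℕ.≤ m ℕ.^ ↧ₙ q

-- Suprema of sets of reals need not be located constructively, and may be
-- infinite, so they are represented by the set of rationals strictly below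
-- them; inclusion of these sets is the order ≤ of extended reals.
LowerReal : (ℓ : Level) → Set (lsuc ℓ)
LowerReal ℓ = Pred ℚ ℓ

sup : ∀ {ℓ} → Pred ℝ ℓ → LowerReal _
sup A q = Σ ℝ λ x → A x × q <ᴿ x

-- The positive real k ^ s for k ≥ 1 and s = a / b rational:
-- a positive p is below it iff p ^ b < k ^ a.
_^ℚ_ : ℕ → ℚ → LowerReal 0ℓ
(k ^ℚ s) p = p ≤ 0ℚ ⊎ below (↥ s)
  where
  infixr 8 _^_
  _^_ = pow +-*-rawSemiring
  k/1 = + k / 1
  below : ℤ → Set
  below (+ a)    = p ^ (↧ₙ s) < k/1 ^ a
  below -[1+ a ] = (p ^ (↧ₙ s)) * (k/1 ^ suc a) < 1ℚ

------------------------------------------------------------------------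
-- The Erdős–Hajnal coefficient

HasEHExponent : ∀ {h} → Tournament h → Pred ℝ _
HasEHExponent H ε =
  0ℚ ≤ᴿ ε ×
  (∀ n → .{{NonZero n}} → (T : Tournament n) → (H -Free) T →
   ∃[ m ] Σ (Fin m ↣ Fin n) λ f → Transitive (T [ f ]) × n ^ ε ≤ₙ m)

EHCoefficient : ∀ {h} → Tournament h → LowerReal _
EHCoefficient H = sup (HasEHExponent H)

-- a k = 1 / k ^ (1 + o(1)) as k → ∞: writing a k = k ^ -(1 + η k), for every
-- δ > 0 eventually -δ ≤ η k ≤ δ.
_≈1/k^[1+o[1]] : ∀ {ℓ} → (ℕ → LowerReal ℓ) → Set ℓ
a ≈1/k^[1+o[1]] =
  ∀ δ → 0ℚ < δ → ∃[ K ] ∀ k → K ℕ.≤ k →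
  ((k ^ℚ (- (1ℚ + δ))) ⊆ a k) × (a k ⊆ (k ^ℚ (- (1ℚ - δ))))

{-# OPTIONS --safe #-}

-- Lower bound.  Grow the path greedily inside two disjoint sets A, B: a vertex of A with many in- and
-- many out-neighbours in B is the next vertex of the path, and what follows is looked for in B.  If
-- this gets stuck before k steps, then there is a pair of sets of relative size k^{-O(k)} that is
-- complete in one direction up to a fraction 1/poly(k) of its arcs.  Iterating inside both sets
-- gives 2^r > 2k layers, r = O(log k), between which almost all arcs go forward.  Reordering the
-- path makes its backward arcs a matching, so it can be embedded in the layers one backward arc at a
-- time, unless two layers contain large subsets A, B with A complete to B.  Hence every P_k-free
-- tournament has such a pair of relative size 1/M, log M = O(k log² k); transitive subtournaments of
-- A and of B combine, and so there is one of order at least |T|^{1/(1 + log₂ M)}.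
--
-- Upper bound.  A random tournament on 2^h vertices has no transitive subtournament of order
-- t = 2h + 2.  Since v₁, v₃, v₅, … is transitive in P_k, it is P_k-free when k ≥ 2t, so that
-- ε(P_k) ≤ log₂ t / h = O(log k / k).
module Submission where

open import Defs

module RationalPowers where

  open import Algebra.Definitions.RawSemiring using () renaming (_^_ to pow)
  open import Data.Integer.Base as ℤ using (ℤ; +_; -[1+_]; ∣_∣)
  import Data.Integer.Properties as ℤ
  open import Data.Nat.Base as ℕ using (ℕ; zero; suc; NonZero)
  import Data.Nat.Properties as ℕ
  open import Data.Nat.Coprimality using (1-coprimeTo)
  open import Data.Product.Base using (_,_)
  open import Data.Sum.Base using (_⊎_; inj₁; inj₂)
  open import Data.Rational.Base hiding (∣_∣; NonZero)
  import Data.Rational.Properties as ℚ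
  import Data.Rational.Unnormalised.Base as ℚᵘ
  import Data.Rational.Unnormalised.Properties as ℚᵘ
  open import Algebra.Properties.CommutativeSemiring.Exp using () renaming (^-distrib-* to pow-distrib)
  open import Algebra.Bundles using (CommutativeRing)
  open import Relation.Binary.PropositionalEquality hiding ([_])
  open import Relation.Nullary.Negation.Core using (contradiction)
  open import Relation.Nullary.Decidable.Core using (yes; no)

  infixr 8 _^_
  _^_ : ℚ → ℕ → ℚ
  _^_ = pow +-*-rawSemiring

  ^-distrib-* : ∀ p q n → (p * q) ^ n ≡ p ^ n * q ^ n
  ^-distrib-* = pow-distrib (CommutativeRing.commutativeSemiring ℚ.+-*-commutativeRing)

  ι : ℕ → ℚ
  ι n = + n / 1

  toℚᵘ-ι : ∀ n → toℚᵘ (ι n) ℚᵘ.≃ ℚᵘ.mkℚᵘ (+ n) 0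
  toℚᵘ-ι n = ℚ.toℚᵘ-fromℚᵘ (ℚᵘ.mkℚᵘ (+ n) 0)

  ι-* : ∀ m n → ι (m ℕ.* n) ≡ ι m * ι n
  ι-* m n = ℚ.toℚᵘ-injective (begin
    toℚᵘ (ι (m ℕ.* n))                              ≈⟨ toℚᵘ-ι (m ℕ.* n) ⟩
    ℚᵘ.mkℚᵘ (+ (m ℕ.* n)) 0                         ≡⟨ cong (λ i → ℚᵘ.mkℚᵘ i 0) (ℤ.pos-* m n) ⟩
    ℚᵘ.mkℚᵘ (+ m) 0 ℚᵘ.* ℚᵘ.mkℚᵘ (+ n) 0            ≈⟨ ℚᵘ.*-cong (toℚᵘ-ι m) (toℚᵘ-ι n) ⟨
    toℚᵘ (ι m) ℚᵘ.* toℚᵘ (ι n)                      ≈⟨ ℚ.toℚᵘ-homo-* (ι m) (ι n) ⟨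
    toℚᵘ (ι m * ι n)                                ∎)
    where open ℚᵘ.≃-Reasoning

  ι-^ : ∀ m n → ι (m ℕ.^ n) ≡ ι m ^ n
  ι-^ m zero    = refl
  ι-^ m (suc n) = trans (ι-* m (m ℕ.^ n)) (cong (ι m *_) (ι-^ m n))

  ι-mono-< : ∀ {m n} → m ℕ.< n → ι m < ι n
  ι-mono-< {m} {n} m<n = ℚ.toℚᵘ-cancel-< (ℚᵘ.<-respˡ-≃ (ℚᵘ.≃-sym (toℚᵘ-ι m)) (ℚᵘ.<-respʳ-≃ (ℚᵘ.≃-sym (toℚᵘ-ι n))
    (ℚᵘ.*<* (ℤ.*-monoʳ-<-pos (+ 1) (ℤ.+<+ m<n)))))

  ι-cancel-< : ∀ {m n} → ι m < ι n → m ℕ.< n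
  ι-cancel-< {m} {n} ιm<ιn with ℚᵘ.<-respˡ-≃ (toℚᵘ-ι m) (ℚᵘ.<-respʳ-≃ (toℚᵘ-ι n) (ℚ.toℚᵘ-mono-< ιm<ιn))
  ... | ℚᵘ.*<* m*1<n*1 = ℤ.drop‿+<+ (subst₂ ℤ._<_ (ℤ.*-identityʳ (+ m)) (ℤ.*-identityʳ (+ n)) m*1<n*1)

  *-denominator : ∀ p → 0ℚ < p → p * ι (↧ₙ p) ≡ ι ∣ ↥ p ∣
  *-denominator p@(mkℚ (+ c) d-1 _) _ = ℚ.toℚᵘ-injective (begin
    toℚᵘ (p * ι (suc d-1))                          ≈⟨ ℚ.toℚᵘ-homo-* p (ι (suc d-1)) ⟩
    toℚᵘ p ℚᵘ.* toℚᵘ (ι (suc d-1))                  ≈⟨ ℚᵘ.*-congˡ {toℚᵘ p} (toℚᵘ-ι (suc d-1)) ⟩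
    ℚᵘ.mkℚᵘ (+ c) d-1 ℚᵘ.* ℚᵘ.mkℚᵘ (+ suc d-1) 0    ≈⟨ ℚᵘ.*≡* (trans (ℤ.*-identityʳ _) (cong (+ c ℤ.*_) (cong +_ (sym (ℕ.*-identityʳ (suc d-1)))))) ⟩
    ℚᵘ.mkℚᵘ (+ c) 0                                 ≈⟨ toℚᵘ-ι c ⟨
    toℚᵘ (ι c)                                      ∎)
    where open ℚᵘ.≃-Reasoning
  *-denominator (mkℚ -[1+ c ] d-1 _) (*<* ())

  module _ (p : ℚ) (0<p : 0ℚ < p) (b k a : ℕ) where
    private
      c = ∣ ↥ p ∣
      d = ↧ₙ p

    clear-denominator : (p ^ b * ι k ^ a) * ι (d ℕ.^ b) ≡ ι (c ℕ.^ b ℕ.* k ℕ.^ a)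
    clear-denominator = begin
      (p ^ b * ι k ^ a) * ι (d ℕ.^ b)     ≡⟨ cong ((p ^ b * ι k ^ a) *_) (ι-^ d b) ⟩
      (p ^ b * ι k ^ a) * ι d ^ b         ≡⟨ ℚ.*-assoc (p ^ b) (ι k ^ a) (ι d ^ b) ⟩
      p ^ b * (ι k ^ a * ι d ^ b)         ≡⟨ cong (p ^ b *_) (ℚ.*-comm (ι k ^ a) (ι d ^ b)) ⟩
      p ^ b * (ι d ^ b * ι k ^ a)         ≡⟨ ℚ.*-assoc (p ^ b) (ι d ^ b) (ι k ^ a) ⟨
      (p ^ b * ι d ^ b) * ι k ^ a         ≡⟨ cong (_* ι k ^ a) (^-distrib-* p (ι d) b) ⟨
      (p * ι d) ^ b * ι k ^ a             ≡⟨ cong (λ q → q ^ b * ι k ^ a) (*-denominator p 0<p) ⟩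
      ι c ^ b * ι k ^ a                   ≡⟨ cong₂ _*_ (ι-^ c b) (ι-^ k a) ⟨
      ι (c ℕ.^ b) * ι (k ℕ.^ a)           ≡⟨ ι-* (c ℕ.^ b) (k ℕ.^ a) ⟨
      ι (c ℕ.^ b ℕ.* k ℕ.^ a)             ∎
      where open ≡-Reasoning

    private
      instance
        d^b≢0 : NonZero (d ℕ.^ b)
        d^b≢0 = ℕ.m^n≢0 d b
      positive-ι : Positive (ι (d ℕ.^ b))
      positive-ι = positive (ι-mono-< (ℕ.>-nonZero⁻¹ (d ℕ.^ b)))

    product<1⁻ : p ^ b * ι k ^ a < 1ℚ → c ℕ.^ b ℕ.* k ℕ.^ a ℕ.< d ℕ.^ b
    product<1⁻ <1 = ι-cancel-< (subst₂ _<_ clear-denominator (ℚ.*-identityˡ _)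
      (ℚ.*-monoˡ-<-pos (ι (d ℕ.^ b)) {{positive-ι}} <1))

    product<1⁺ : c ℕ.^ b ℕ.* k ℕ.^ a ℕ.< d ℕ.^ b → p ^ b * ι k ^ a < 1ℚ
    product<1⁺ < = ℚ.*-cancelʳ-<-nonNeg (ι (d ℕ.^ b)) {{ℚ.pos⇒nonNeg (ι (d ℕ.^ b)) {{positive-ι}}}}
      (subst₂ _<_ (sym clear-denominator) (sym (ℚ.*-identityˡ _)) (ι-mono-< <))

  -- With p = c / d and s = a / b > - 1 we have a ≥ 1 - b, so that p < k ^ s follows from
  -- c ^ b * k ^ (b - 1) < d ^ b; similarly a ≤ - (b + 1) if s < - 1.
  ∈-^ℚ⁺ : ∀ k .{{_ : NonZero k}} s p → - 1ℚ < s → 0ℚ < p →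
          ∣ ↥ p ∣ ℕ.^ ↧ₙ s ℕ.* k ℕ.^ ℕ.pred (↧ₙ s) ℕ.< ↧ₙ p ℕ.^ ↧ₙ s → (k ^ℚ s) p
  ∈-^ℚ⁺ k s@(mkℚ (+ a) b-1 _) p _ 0<p < = inj₂ (ℚ.<-≤-trans
    (subst (_< 1ℚ) (ℚ.*-identityʳ (p ^ suc b-1)) (product<1⁺ p 0<p (suc b-1) k 0
      (ℕ.≤-<-trans (ℕ.*-monoʳ-≤ (∣ ↥ p ∣ ℕ.^ suc b-1) (ℕ.m^n>0 k b-1)) <)))
    (subst (1ℚ ≤_) (ι-^ k a) (1≤ι (ℕ.m^n>0 k a))))
    where
    1≤ι : ∀ {n} → 1 ℕ.≤ n → 1ℚ ≤ ι n
    1≤ι {n} 1≤n = ℚ.≮⇒≥ (λ ιn<1 → ℕ.<⇒≱ (ι-cancel-< {n} {1} ιn<1) 1≤n)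
  ∈-^ℚ⁺ k s@(mkℚ -[1+ a ] b-1 _) p (*<* -b<-a) 0<p < = inj₂ (product<1⁺ p 0<p (suc b-1) k (suc a)
    (ℕ.≤-<-trans (ℕ.*-monoʳ-≤ (∣ ↥ p ∣ ℕ.^ suc b-1) (ℕ.^-monoʳ-≤ k (bound -b<-a))) <))
    where
    bound : -[1+ 0 ] ℤ.* + suc b-1 ℤ.< -[1+ a ] ℤ.* + 1 → suc a ℕ.≤ b-1
    bound lt with subst₂ ℤ._<_ (cong -[1+_] (ℕ.+-identityʳ b-1)) (ℤ.*-identityʳ -[1+ a ]) lt
    ... | ℤ.-<- a<b = a<b

  ∈-^ℚ⁻ : ∀ k .{{_ : NonZero k}} s p → s < - 1ℚ → 0ℚ < p → (k ^ℚ s) p →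
          ∣ ↥ p ∣ ℕ.^ ↧ₙ s ℕ.* k ℕ.^ suc (↧ₙ s) ℕ.< ↧ₙ p ℕ.^ ↧ₙ s
  ∈-^ℚ⁻ k s p s<-1 0<p (inj₁ p≤0) = contradiction (ℚ.<-≤-trans 0<p p≤0) (ℚ.<-irrefl refl)
  ∈-^ℚ⁻ k s@(mkℚ (+ a) b-1 _) p (*<* a<-b) 0<p (inj₂ _) with subst (ℤ._< _) (ℤ.*-identityʳ (+ a)) a<-b
  ... | ()
  ∈-^ℚ⁻ k s@(mkℚ -[1+ a ] b-1 _) p (*<* -a<-b) 0<p (inj₂ <1) =
    ℕ.≤-<-trans (ℕ.*-monoʳ-≤ (∣ ↥ p ∣ ℕ.^ suc b-1) (ℕ.^-monoʳ-≤ k (bound -a<-b))) (product<1⁻ p 0<p (suc b-1) k (suc a) <1)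
    where
    bound : -[1+ a ] ℤ.* + 1 ℤ.< -[1+ 0 ] ℤ.* + suc b-1 → suc (suc b-1) ℕ.≤ suc a
    bound lt with subst₂ ℤ._<_ (ℤ.*-identityʳ -[1+ a ]) (cong -[1+_] (ℕ.+-identityʳ b-1)) lt
    ... | ℤ.-<- b<a = ℕ.s≤s b<a

  fromℚ : ℚ → ℝ
  fromℚ q = record
    { lower         = _< q
    ; upper         = q <_
    ; lower-inhab   = q - 1ℚ , q-1<q
    ; upper-inhab   = q + 1ℚ , subst (_< q + 1ℚ) (ℚ.+-identityʳ q) (ℚ.+-monoʳ-< q 0<1)
    ; lower-closed  = ℚ.<-trans
    ; upper-closed  = λ p<r q<p → ℚ.<-trans q<p p<r
    ; lower-rounded = λ p<q → ℚ.<-dense p<q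
    ; upper-rounded = λ q<p → let (r , q<r , r<p) = ℚ.<-dense q<p in r , r<p , q<r
    ; disjoint      = λ (p<q , q<p) → ℚ.<-asym p<q q<p
    ; located       = located
    }
    where
    0<1 : 0ℚ < 1ℚ
    0<1 = *<* (ℤ.+<+ (ℕ.s≤s ℕ.z≤n))
    q-1<q : q - 1ℚ < q
    q-1<q = subst (q - 1ℚ <_) (ℚ.+-identityʳ q) (ℚ.+-monoʳ-< q (*<* ℤ.-<+))
    located : ∀ {p r} → p < r → p < q ⊎ q < r
    located {p} {r} p<r with p ℚ.<? q
    ... | yes p<q = inj₁ p<q
    ... | no p≮q  = inj₂ (ℚ.≤-<-trans (ℚ.≮⇒≥ p≮q) p<r)

  1/suc : ℕ → ℚ
  1/suc L = mkℚ (+ 1) L (1-coprimeTo (suc L))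

  <1/suc : ∀ L p → ∣ ↥ p ∣ ℕ.* suc L ℕ.< ↧ₙ p → p < 1/suc L
  <1/suc L (mkℚ (+ c) d-1 _) cL<d = *<* (subst₂ ℤ._<_ (ℤ.pos-* c (suc L)) (sym (ℤ.*-identityˡ _)) (ℤ.+<+ cL<d))
  <1/suc L (mkℚ -[1+ c ] d-1 _) _ = *<* ℤ.-<+

  ≤1/suc : ∀ L q → 0ℚ ≤ q → q ≤ 1/suc L → ∣ ↥ q ∣ ℕ.* suc L ℕ.≤ ↧ₙ q
  ≤1/suc L (mkℚ (+ a) b-1 _) _ (*≤* aL≤b) = ℤ.drop‿+≤+ (subst₂ ℤ._≤_ (sym (ℤ.pos-* a (suc L))) (ℤ.*-identityˡ _) aL≤b)
  ≤1/suc L (mkℚ -[1+ a ] b-1 _) (*≤* ()) _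

open RationalPowers using (∈-^ℚ⁺; ∈-^ℚ⁻; fromℚ; 1/suc; <1/suc; ≤1/suc)

open import Data.Bool.Base using (Bool; true; false; not; if_then_else_)
import Data.Bool.Properties as Bool
open import Data.Empty using (⊥)
open import Data.Fin.Base
  using (Fin; zero; suc; toℕ; inject₁; fromℕ; fromℕ<; combine; remQuot) renaming (_<_ to _<ᶠ_)
open import Data.Fin.Properties
  using (toℕ-injective; toℕ-fromℕ<; toℕ<n; injective⇒≤; combine-remQuot; remQuot-combine; combine-injective)
  renaming (_≟_ to _≟ᶠ_; _<?_ to _<ᶠ?_; <-cmp to <ᶠ-cmp)
open import Data.Integer.Base using (∣_∣)
open import Data.List.Base
  using (List; []; _∷_; _++_; map; filter; length; lookup; take; drop; allFin; tabulate; cartesianProductWith)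
open import Data.List.Membership.DecPropositional using () renaming (_∈?_ to member?)
open import Data.List.Membership.Propositional using (_∈_; find; lose)
open import Data.List.Membership.Propositional.Properties
  using ( ∈-filter⁺; ∈-filter⁻; ∈-++⁺ˡ; ∈-++⁺ʳ; ∈-++⁻; ∈-map⁺; ∈-map⁻; ∈-lookup; ∈-allFin
        ; ∈-cartesianProductWith⁺ )
open import Data.List.Properties
  using ( length-filter; length-++; length-take; length-drop; length-map; length-tabulate
        ; filter-++; filter-none; filter-all )
open import Data.List.Relation.Unary.All as All using (All; []; _∷_)
import Data.List.Relation.Unary.All.Properties as All
open import Data.List.Relation.Unary.AllPairs as AllPairs using (AllPairs; []; _∷_)
import Data.List.Relation.Unary.AllPairs.Properties as AllPairs
open import Data.List.Relation.Unary.Any using (here; there; any?)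
open import Data.List.Relation.Unary.Unique.DecPropositional using () renaming (unique? to uniq?)
open import Data.List.Relation.Unary.Unique.Propositional using (Unique)
import Data.List.Relation.Unary.Unique.Propositional.Properties as Unique
open import Data.Maybe.Base using (Maybe; just; nothing)
open import Data.Maybe.Properties using (≡-dec)
open import Data.Nat.Base hiding (_/_; _%_)
open import Data.Nat.DivMod using (_/_; _%_; m≡m%n+[m/n]*n; m%n<n; m/n*n≤m; /-monoˡ-≤)
open import Data.Nat.Properties
open import Data.Nat.Tactic.RingSolver using (solve-∀)
open import Data.Product.Base using (Σ; ∃-syntax; _×_; _,_; proj₁; proj₂)
open import Data.Rational.Base as ℚ using (ℚ; 0ℚ; 1ℚ; ↥_; ↧ₙ_)
import Data.Rational.Properties as ℚ
open import Data.Sum.Base using (_⊎_; inj₁; inj₂; [_,_]′; swap)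
open import Function.Base using (_∘_; id; _on_)
open import Function.Bundles using (_↣_; mk↣; mk⤖; mk⇔; Injection; Bijection; Equivalence)
open import Level using (Level)
open import Relation.Binary.Definitions using (tri<; tri≈; tri>)
open import Relation.Binary.PropositionalEquality hiding ([_])
open import Relation.Nullary.Decidable.Core
  using (Dec; yes; no; does; _because_; ¬?; _×-dec_; _⊎-dec_; decidable-stable)
open import Relation.Nullary.Negation.Core using (¬_; contradiction)
open import Relation.Unary using (Pred; Decidable; _⊆_)

-- Counting in lists

module Counting where

  private variable
    a p q : Level
    A B : Set a

  ∑ : (A → ℕ) → List A → ℕ
  ∑ f []       = 0
  ∑ f (x ∷ xs) = f x + ∑ f xs

  #_ : {P : Set p} → Dec P → ℕ
  # P? = if does P? then 1 else 0

  count : {P : Pred A p} → Decidable P → List A → ℕ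
  count P? xs = length (filter P? xs)

  ∑-++ : (f : A → ℕ) (xs : List A) {ys : List A} → ∑ f (xs ++ ys) ≡ ∑ f xs + ∑ f ys
  ∑-++ f []       = refl
  ∑-++ f (x ∷ xs) {ys} = trans (cong (f x +_) (∑-++ f xs)) (sym (+-assoc (f x) (∑ f xs) (∑ f ys)))

  ∑-cong : {f g : A → ℕ} (xs : List A) → (∀ x → f x ≡ g x) → ∑ f xs ≡ ∑ g xs
  ∑-cong []       f≡g = refl
  ∑-cong (x ∷ xs) f≡g = cong₂ _+_ (f≡g x) (∑-cong xs f≡g)

  ∑-+ : (f g : A → ℕ) (xs : List A) → ∑ (λ x → f x + g x) xs ≡ ∑ f xs + ∑ g xs
  ∑-+ f g []       = refl
  ∑-+ f g (x ∷ xs) = trans (cong (f x + g x +_) (∑-+ f g xs)) (lemma (f x) (g x) (∑ f xs) (∑ g xs))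
    where
    lemma : ∀ a b c d → a + b + (c + d) ≡ a + c + (b + d)
    lemma = solve-∀

  ∑-swap : (f : A → B → ℕ) (xs : List A) (ys : List B) →
           ∑ (λ x → ∑ (f x) ys) xs ≡ ∑ (λ y → ∑ (λ x → f x y) xs) ys
  ∑-swap f []       []       = refl
  ∑-swap f []       (y ∷ ys) = ∑-swap f [] ys
  ∑-swap f (x ∷ xs) ys = begin
    ∑ (f x) ys + ∑ (λ x → ∑ (f x) ys) xs              ≡⟨ cong (∑ (f x) ys +_) (∑-swap f xs ys) ⟩
    ∑ (f x) ys + ∑ (λ y → ∑ (λ x → f x y) xs) ys      ≡⟨ ∑-+ (f x) _ ys ⟨
    ∑ (λ y → ∑ (λ x → f x y) (x ∷ xs)) ys             ∎
    where open ≡-Reasoning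

  ∑≤length* : {f : A → ℕ} {c : ℕ} (d : ℕ) (xs : List A) → (∀ {x} → x ∈ xs → d * f x ≤ c) →
              d * ∑ f xs ≤ length xs * c
  ∑≤length* d []       f≤c = ≤-reflexive (*-zeroʳ d)
  ∑≤length* {f = f} d (x ∷ xs) f≤c = ≤-trans (≤-reflexive (*-distribˡ-+ d (f x) (∑ f xs)))
    (+-mono-≤ (f≤c (here refl)) (∑≤length* d xs (f≤c ∘ there)))

  module _ {P : Pred A p} (P? : Decidable P) where

    count≡∑ : ∀ xs → count P? xs ≡ ∑ (λ x → # P? x) xs
    count≡∑ [] = refl
    count≡∑ (x ∷ xs) with P? x
    ... | true  because _ = cong suc (count≡∑ xs)
    ... | false because _ = count≡∑ xs

    count-++ : ∀ xs {ys} → count P? (xs ++ ys) ≡ count P? xs + count P? ys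
    count-++ xs {ys} = trans (cong length (filter-++ P? xs ys)) (length-++ (filter P? xs))

    markov : {f : A → ℕ} (c : ℕ) → (∀ x → ¬ P x → c ≤ f x) →
             ∀ xs → c * count (¬? ∘ P?) xs ≤ ∑ f xs
    markov c c≤f [] = ≤-reflexive (*-zeroʳ c)
    markov {f} c c≤f (x ∷ xs) with P? x
    ... | yes _ = ≤-trans (markov c c≤f xs) (m≤n+m _ (f x))
    ... | no ¬Px = ≤-trans (≤-reflexive (*-suc c _)) (+-mono-≤ (c≤f x ¬Px) (markov c c≤f xs))

    count-complement : ∀ xs → count P? xs + count (¬? ∘ P?) xs ≡ length xs
    count-complement [] = refl
    count-complement (x ∷ xs) with P? x
    ... | true  because _ = cong suc (count-complement xs)
    ... | false because _ = trans (+-suc _ _) (cong suc (count-complement xs))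

    module _ {Q : Pred A q} (Q? : Decidable Q) where

      count-mono : ∀ xs → (∀ {x} → x ∈ xs → P x → Q x) → count P? xs ≤ count Q? xs
      count-mono [] P⊆Q = z≤n
      count-mono (x ∷ xs) P⊆Q with P? x | Q? x
      ... | yes _  | yes _  = s≤s (count-mono xs (P⊆Q ∘ there))
      ... | yes Px | no ¬Qx = contradiction (P⊆Q (here refl) Px) ¬Qx
      ... | no _   | yes _  = m≤n⇒m≤1+n (count-mono xs (P⊆Q ∘ there))
      ... | no _   | no _   = count-mono xs (P⊆Q ∘ there)

      count-filter-≤ : ∀ xs → count P? (filter Q? xs) ≤ count P? xs
      count-filter-≤ [] = z≤n
      count-filter-≤ (x ∷ xs) with Q? x
      count-filter-≤ (x ∷ xs) | no _ with P? x
      ... | yes _ = m≤n⇒m≤1+n (count-filter-≤ xs)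
      ... | no _  = count-filter-≤ xs
      count-filter-≤ (x ∷ xs) | yes _ with P? x
      ... | yes _ = s≤s (count-filter-≤ xs)
      ... | no _  = count-filter-≤ xs

      count≤count-filter+ : ∀ xs → count P? xs ≤ count P? (filter Q? xs) + count (¬? ∘ Q?) xs
      count≤count-filter+ [] = z≤n
      count≤count-filter+ (x ∷ xs) with Q? x
      count≤count-filter+ (x ∷ xs) | no _ with P? x
      ... | yes _ = ≤-trans (s≤s (count≤count-filter+ xs)) (≤-reflexive (sym (+-suc _ _)))
      ... | no _  = ≤-trans (count≤count-filter+ xs) (+-monoʳ-≤ (count P? (filter Q? xs)) (n≤1+n _))
      count≤count-filter+ (x ∷ xs) | yes _ with P? x
      ... | yes _ = s≤s (count≤count-filter+ xs)
      ... | no _  = count≤count-filter+ xs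

  module _ {R : A → B → Set p} (R? : ∀ x y → Dec (R x y)) where

    double-counting : ∀ xs ys →
      ∑ (λ x → count (R? x) ys) xs ≡ ∑ (λ y → count (λ x → R? x y) xs) ys
    double-counting xs ys = begin
      ∑ (λ x → count (R? x) ys) xs            ≡⟨ ∑-cong xs (λ x → count≡∑ (R? x) ys) ⟩
      ∑ (λ x → ∑ (λ y → # R? x y) ys) xs      ≡⟨ ∑-swap (λ x y → # R? x y) xs ys ⟩
      ∑ (λ y → ∑ (λ x → # R? x y) xs) ys      ≡⟨ ∑-cong ys (λ y → count≡∑ (λ x → R? x y) xs) ⟨
      ∑ (λ y → count (λ x → R? x y) xs) ys    ∎
      where open ≡-Reasoning

open Counting

-- Paths and nearly complete pairs

module TournamentProperties {n} (T : Tournament n) where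
  open Tournament T public

  infix 4 _⟶?_
  _⟶?_ : ∀ u v → Dec (u ⟶ v)
  u ⟶? v with u ≟ᶠ v
  ... | yes refl = no (loopless u)
  ... | no u≢v with exactlyOne u≢v
  ...   | inj₁ (u⟶v , _) = yes u⟶v
  ...   | inj₂ (¬u⟶v , _) = no ¬u⟶v

  ⟶⇒≢ : ∀ {u v} → u ⟶ v → u ≢ v
  ⟶⇒≢ u⟶u refl = loopless _ u⟶u

  ⟶-asym : ∀ {u v} → u ⟶ v → ¬ (v ⟶ u)
  ⟶-asym u⟶v v⟶u with exactlyOne (⟶⇒≢ u⟶v)
  ... | inj₁ (_ , ¬v⟶u) = ¬v⟶u v⟶u
  ... | inj₂ (¬u⟶v , _) = ¬u⟶v u⟶v

  ⟶-flip : ∀ {u v} → u ≢ v → ¬ (u ⟶ v) → v ⟶ u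
  ⟶-flip u≢v ¬u⟶v with exactlyOne u≢v
  ... | inj₁ (u⟶v , _) = contradiction u⟶v ¬u⟶v
  ... | inj₂ (_ , v⟶u) = v⟶u

homomorphism⇒¬free : ∀ {m n} (S : Tournament m) (T : Tournament n) (g : Fin m → Fin n) →
                     (∀ u v → Tournament._⟶_ S u v → Tournament._⟶_ T (g u) (g v)) →
                     ¬ (S -Free) T
homomorphism⇒¬free {m} S T g hom free = free (m , embedding , record
  { bijection = mk⤖ (id , λ y → y , id)
  ; edges     = λ u v → mk⇔ (reflects u v) (hom u v)
  })
  where
  module S = TournamentProperties S
  module T = TournamentProperties T
  injective : ∀ {u v} → g u ≡ g v → u ≡ v
  injective {u} {v} gu≡gv with u ≟ᶠ v
  ... | yes u≡v = u≡v
  ... | no u≢v with S.exactlyOne u≢v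
  ...   | inj₁ (u⟶v , _) = contradiction gu≡gv (T.⟶⇒≢ (hom u v u⟶v))
  ...   | inj₂ (_ , v⟶u) = contradiction (sym gu≡gv) (T.⟶⇒≢ (hom v u v⟶u))
  embedding = mk↣ injective
  reflects : ∀ u v → g u T.⟶ g v → u S.⟶ v
  reflects u v gu⟶gv = S.⟶-flip (λ { refl → T.loopless _ gu⟶gv })
                                 (λ v⟶u → T.⟶-asym gu⟶gv (hom v u v⟶u))

module _ {n} (T : Tournament n) where
  open TournamentProperties T

  private
    V = Fin n

  data IsPath : List V → Set where
    []   : IsPath []
    [-]  : ∀ {x} → IsPath (x ∷ [])
    link : ∀ {x y ys} → y ⟶ x → All (x ⟶_) ys → IsPath (y ∷ ys) → IsPath (x ∷ y ∷ ys)

  IsPath-tail : ∀ {x xs} → IsPath (x ∷ xs) → IsPath xs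
  IsPath-tail [-]         = []
  IsPath-tail (link _ _ p) = p

  IsPath-lookup : ∀ {xs} → IsPath xs → ∀ u v → Tournament._⟶_ (P (length xs)) u v →
                  lookup xs u ⟶ lookup xs v
  IsPath-lookup {_ ∷ _} p (suc u) (suc v) (inj₁ u≡1+v) =
    IsPath-lookup (IsPath-tail p) u v (inj₁ (suc-injective u≡1+v))
  IsPath-lookup {_ ∷ _} p (suc u) (suc v) (inj₂ (s≤s u<v , v≢1+u)) =
    IsPath-lookup (IsPath-tail p) u v (inj₂ (u<v , v≢1+u ∘ cong suc))
  IsPath-lookup (link y⟶x _ _) (suc zero) zero (inj₁ _) = y⟶x
  IsPath-lookup {_ ∷ _ ∷ _} p zero (suc zero) (inj₂ (_ , 1≢1)) = contradiction refl 1≢1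
  IsPath-lookup (link _ x⟶ys _) zero (suc (suc v)) (inj₂ _) = All.lookup x⟶ys (∈-lookup v)

  IsPath-take : ∀ k {xs} → IsPath xs → IsPath (take k xs)
  IsPath-take zero    _   = []
  IsPath-take (suc k) []  = []
  IsPath-take (suc zero)    [-] = [-]
  IsPath-take (suc (suc k)) [-] = [-]
  IsPath-take (suc zero) (link _ _ _) = [-]
  IsPath-take (suc (suc k)) (link y⟶x x⟶ys p) = link y⟶x (All.take⁺ k x⟶ys) (IsPath-take (suc k) p)

  IsPath⇒¬free : ∀ {k xs} → IsPath xs → k ≤ length xs → ¬ (P k -Free) T
  IsPath⇒¬free {k} {xs} p k≤ = go (IsPath-take k p) (trans (length-take k xs) (m≤n⇒m⊓n≡m k≤))
    where
    go : ∀ {ys} → IsPath ys → length ys ≡ k → ¬ (P k -Free) T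
    go {ys} q refl = homomorphism⇒¬free (P _) T (lookup ys) (IsPath-lookup q)

  Disjoint : List V → List V → Set
  Disjoint A B = ∀ {v} → v ∈ A → v ∈ B → ⊥

  non-out : V → List V → List V
  non-out v = filter (λ b → ¬? (v ⟶? b))

  non-in : V → List V → List V
  non-in v = filter (λ b → ¬? (b ⟶? v))

  record NearlyComplete (D s : ℕ) (X : List V) : Set where
    field
      A B      : List V
      A-unique : Unique A
      B-unique : Unique B
      A⊆X      : ∀ {v} → v ∈ A → v ∈ X
      B⊆X      : ∀ {v} → v ∈ B → v ∈ X
      disjoint : Disjoint A B
      s≤∣A∣    : s ≤ length A
      s≤∣B∣    : s ≤ length B
      nearly   : (∀ {a} → a ∈ A → D * length (non-out a B) ≤ length B) ⊎
                 (∀ {a} → a ∈ A → D * length (non-in a B) ≤ length B)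

  module _ (D s : ℕ) .{{_ : NonZero D}} .{{_ : NonZero s}} (X : List V) where

    -- Either some vertex of A has many in-neighbours and many out-neighbours in B, and the path is
    -- continued through its in-neighbours, the out-neighbours being the candidates for what
    -- comes later; or a half of A is nearly complete to, or nearly complete from, B.
    path-or-nearlyComplete : ∀ j {A B} → Unique A → Unique B →
      (∀ {v} → v ∈ A → v ∈ X) → (∀ {v} → v ∈ B → v ∈ X) → Disjoint A B →
      2 * s ≤ length A → 2 * s * D ^ j ≤ length B →
      (∃[ x ] ∃[ ys ] x ∈ A × (∀ {y} → y ∈ ys → y ∈ B) × IsPath (x ∷ ys) × length ys ≡ j) ⊎
      NearlyComplete D s X
    path-or-nearlyComplete zero {[]} uA uB A⊆X B⊆X dis 2s≤A 2s≤B =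
      contradiction 2s≤A (<⇒≱ (>-nonZero⁻¹ (2 * s) {{m*n≢0 2 s}}))
    path-or-nearlyComplete zero {x ∷ A} uA uB A⊆X B⊆X dis 2s≤A 2s≤B =
      inj₁ (x , [] , here refl , (λ ()) , [-] , refl)
    path-or-nearlyComplete (suc j) {A} {B} uA uB A⊆X B⊆X dis 2s≤A 2sD≤B
      with any? (λ v → (length B <? D * length (non-out v B)) ×-dec
                       (length B <? D * length (non-in v B))) A
    ... | yes mixed = let (v , v∈A , B<in , B<out) = find mixed in extend v v∈A B<in B<out
      where
      large : ∀ {c} → length B < D * c → 2 * s * D ^ j ≤ c
      large {c} B<Dc = <⇒≤ (*-cancelˡ-< D _ c (begin-strict
        D * (2 * s * D ^ j)   ≡⟨ lemma D s (D ^ j) ⟩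
        2 * s * (D * D ^ j)   ≤⟨ 2sD≤B ⟩
        length B              <⟨ B<Dc ⟩
        D * c                 ∎))
        where
        open ≤-Reasoning
        lemma : ∀ d s e → d * (2 * s * e) ≡ 2 * s * (d * e)
        lemma = solve-∀
      extend : ∀ v → v ∈ A → length B < D * length (non-out v B) → length B < D * length (non-in v B) → _
      extend v v∈A B<in B<out = [ inj₁ ∘ prolong , inj₂ ]′
            (path-or-nearlyComplete j {non-out v B} {non-in v B}
               (Unique.filter⁺ _ uB) (Unique.filter⁺ _ uB)
               (B⊆X ∘ proj₁ ∘ ∈-filter⁻ _) (B⊆X ∘ proj₁ ∘ ∈-filter⁻ _)
               (λ u∈out u∈in → ⟶-asym (from-out u∈out) (to-in u∈in))
               (≤-trans (m≤m*n (2 * s) (D ^ j) {{m^n≢0 D j}}) (large B<in)) (large B<out))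
        where
        v≢ : ∀ {b} → b ∈ B → v ≢ b
        v≢ b∈B refl = dis v∈A b∈B
        from-out : ∀ {b} → b ∈ non-out v B → b ⟶ v
        from-out b∈ = let (b∈B , ¬v⟶b) = ∈-filter⁻ _ b∈ in ⟶-flip (v≢ b∈B) ¬v⟶b
        to-in : ∀ {b} → b ∈ non-in v B → v ⟶ b
        to-in b∈ = let (b∈B , ¬b⟶v) = ∈-filter⁻ _ b∈ in ⟶-flip (v≢ b∈B ∘ sym) ¬b⟶v
        prolong : _ → _
        prolong (x , ys , x∈out , ys⊆in , path , len) = v , x ∷ ys , v∈A ,
          (λ { (here refl) → proj₁ (∈-filter⁻ _ x∈out) ; (there y∈ys) → proj₁ (∈-filter⁻ _ (ys⊆in y∈ys)) }) ,
          link (from-out x∈out) (All.tabulate (to-in ∘ ys⊆in)) path , cong suc len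
    ... | no ¬mixed = inj₂ pure
      where
      OutPure? = λ v → D * length (non-out v B) ≤? length B
      A₁ = filter OutPure? A
      A₂ = filter (¬? ∘ OutPure?) A
      s≤B : s ≤ length B
      s≤B = ≤-trans (m≤n*m s 2) (≤-trans (m≤m*n (2 * s) (D ^ suc j) {{m^n≢0 D (suc j)}}) 2sD≤B)
      in-pure : ∀ {a} → a ∈ A₂ → D * length (non-in a B) ≤ length B
      in-pure a∈A₂ = let (a∈A , ¬out) = ∈-filter⁻ (¬? ∘ OutPure?) a∈A₂ in
        ≮⇒≥ (λ B<in → ¬mixed (lose a∈A (≰⇒> ¬out , B<in)))
      pure : NearlyComplete D s X
      pure with s ≤? length A₁
      ... | yes s≤A₁ = record
        { A = A₁ ; B = B ; A-unique = Unique.filter⁺ _ uA ; B-unique = uB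
        ; A⊆X = A⊆X ∘ proj₁ ∘ ∈-filter⁻ _ ; B⊆X = B⊆X ; disjoint = dis ∘ proj₁ ∘ ∈-filter⁻ _
        ; s≤∣A∣ = s≤A₁ ; s≤∣B∣ = s≤B
        ; nearly = inj₁ (proj₂ ∘ ∈-filter⁻ OutPure? {xs = A})
        }
      ... | no s≰A₁ = record
        { A = A₂ ; B = B ; A-unique = Unique.filter⁺ _ uA ; B-unique = uB
        ; A⊆X = A⊆X ∘ proj₁ ∘ ∈-filter⁻ _ ; B⊆X = B⊆X ; disjoint = dis ∘ proj₁ ∘ ∈-filter⁻ _
        ; s≤∣A∣ = s≤A₂ ; s≤∣B∣ = s≤B
        ; nearly = inj₂ in-pure
        }
        where
        s≤A₂ : s ≤ length A₂
        s≤A₂ = +-cancelˡ-≤ s s (length A₂) (begin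
          s + s                    ≡⟨ cong (s +_) (+-identityʳ s) ⟨
          2 * s                    ≤⟨ 2s≤A ⟩
          length A                 ≡⟨ count-complement OutPure? A ⟨
          length A₁ + length A₂    ≤⟨ +-monoˡ-≤ (length A₂) (<⇒≤ (≰⇒> s≰A₁)) ⟩
          s + length A₂            ∎)
          where open ≤-Reasoning

-- Layers

∈-take : ∀ {A : Set} m {xs : List A} {x} → x ∈ take m xs → x ∈ xs
∈-take (suc m) {_ ∷ _} (here eq)  = here eq
∈-take (suc m) {_ ∷ _} (there x∈) = there (∈-take m x∈)

∈-drop : ∀ {A : Set} m {xs : List A} {x} → x ∈ drop m xs → x ∈ xs
∈-drop zero x∈ = x∈
∈-drop (suc m) {_ ∷ _} x∈ = there (∈-drop m x∈)

module _ {n} (T : Tournament n) where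
  open TournamentProperties T

  private
    V = Fin n

  unique⇒take-drop-disjoint : ∀ m {xs} → Unique xs → Disjoint T (take m xs) (drop m xs)
  unique⇒take-drop-disjoint (suc m) (x∉xs ∷ uxs) (here refl) x∈drop =
    All.lookup x∉xs (∈-drop m x∈drop) refl
  unique⇒take-drop-disjoint (suc m) (x∉xs ∷ uxs) (there x∈take) x∈drop =
    unique⇒take-drop-disjoint m uxs x∈take x∈drop

  -- A sequence of layers of vertices is encoded as one list of vertices with layer numbers.
  Labelled = ℕ × V

  Bad : Labelled → Labelled → Set
  Bad (i , x) (j , y) = (i < j × ¬ (x ⟶ y)) ⊎ (j < i × ¬ (y ⟶ x))

  Bad? : ∀ p q → Dec (Bad p q)
  Bad? (i , x) (j , y) = (i <? j ×-dec ¬? (x ⟶? y)) ⊎-dec (j <? i ×-dec ¬? (y ⟶? x))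

  good⇒⟶ : ∀ {i x j y} → ¬ Bad (i , x) (j , y) → i < j → x ⟶ y
  good⇒⟶ {x = x} {y = y} good i<j with x ⟶? y
  ... | yes x⟶y = x⟶y
  ... | no ¬x⟶y = contradiction (inj₁ (i<j , ¬x⟶y)) good

  bad : List Labelled → List Labelled → ℕ
  bad U W = ∑ (λ p → count (Bad? p) W) U

  bad-comm : ∀ U W → bad U W ≡ bad W U
  bad-comm U W = trans (double-counting Bad? U W) (∑-cong W (λ w → ≤-antisym
    (count-mono (λ u → Bad? u w) (Bad? w) U (λ _ → swap))
    (count-mono (Bad? w) (λ u → Bad? u w) U (λ _ → swap))))

  bad-++ : ∀ U W → bad (U ++ W) (U ++ W) ≡ bad U U + bad W W + 2 * bad W U
  bad-++ U W = begin
    bad (U ++ W) (U ++ W)                          ≡⟨ ∑-++ _ U ⟩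
    bad U (U ++ W) + bad W (U ++ W)                ≡⟨ cong₂ _+_ (split U) (split W) ⟩
    (bad U U + bad U W) + (bad W U + bad W W)      ≡⟨ cong (λ b → bad U U + b + (bad W U + bad W W)) (bad-comm U W) ⟩
    (bad U U + bad W U) + (bad W U + bad W W)      ≡⟨ lemma (bad U U) (bad W U) (bad W W) ⟩
    bad U U + bad W W + 2 * bad W U                ∎
    where
    open ≡-Reasoning
    split : ∀ Z → bad Z (U ++ W) ≡ bad Z U + bad Z W
    split Z = trans (∑-cong Z (λ z → count-++ (Bad? z) U)) (∑-+ _ _ Z)
    lemma : ∀ a b c → a + b + (b + c) ≡ a + c + 2 * b
    lemma = solve-∀

  label? : ∀ i → Decidable {A = Labelled} (λ p → proj₁ p ≡ i)
  label? i p = proj₁ p ≟ i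

  layer : ℕ → List Labelled → List Labelled
  layer i = filter (label? i)

  record Layers (D m o r : ℕ) (X : List V) : Set where
    field
      W        : List Labelled
      W⊆X      : ∀ {p} → p ∈ W → proj₂ p ∈ X
      lo       : ∀ {p} → p ∈ W → o ≤ proj₁ p
      hi       : ∀ {p} → p ∈ W → proj₁ p < o + 2 ^ r
      distinct : AllPairs (_≢_ on proj₂) W
      size     : length W ≤ 2 ^ r * m
      layers   : ∀ {i} → o ≤ i → i < o + 2 ^ r → m ≤ length (layer i W)
      few      : D * bad W W ≤ 2 * ((2 ^ r * m) * (2 ^ r * m))

  layers-widen : ∀ {D m o r X Y} → (∀ {x} → x ∈ X → x ∈ Y) → Layers D m o r X → Layers D m o r Y
  layers-widen X⊆Y L = record { Layers L ; W⊆X = X⊆Y ∘ Layers.W⊆X L }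

  layers-zero : ∀ {D m o X} → Unique X → m ≤ length X → Layers D m o 0 X
  layers-zero {D} {m} {o} {X} uX m≤X = record
    { W        = W
    ; W⊆X      = λ p∈W → let (x , x∈X , eq) = ∈-W p∈W in subst (_∈ X) (cong proj₂ (sym eq)) x∈X
    ; lo       = λ p∈W → ≤-reflexive (sym (label p∈W))
    ; hi       = λ p∈W → ≤-reflexive (trans (cong suc (label p∈W)) (+-comm 1 o))
    ; distinct = AllPairs.map⁺ (Unique.take⁺ m uX)
    ; size     = ≤-reflexive (trans ∣W∣≡m (sym (+-identityʳ m)))
    ; layers   = λ o≤i i<o+1 → ≤-reflexive (sym (trans (cong length (filter-all (label? _)
                   (All.tabulate λ p∈W → trans (label p∈W)
                     (≤-antisym o≤i (s≤s⁻¹ (≤-trans i<o+1 (≤-reflexive (+-comm o 1)))))))) ∣W∣≡m))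
    ; few      = ≤-trans (≤-reflexive (trans (cong (D *_) none) (*-zeroʳ D))) z≤n
    }
    where
    W = map (o ,_) (take m X)
    ∈-W : ∀ {p} → p ∈ W → ∃[ x ] x ∈ X × p ≡ (o , x)
    ∈-W p∈W = let (x , x∈ , eq) = ∈-map⁻ (o ,_) p∈W in x , ∈-take m x∈ , eq
    label : ∀ {p} → p ∈ W → proj₁ p ≡ o
    label p∈W = cong proj₁ (proj₂ (proj₂ (∈-W p∈W)))
    ∣W∣≡m : length W ≡ m
    ∣W∣≡m = trans (length-map (o ,_) (take m X)) (trans (length-take m X) (m≤n⇒m⊓n≡m m≤X))
    ¬bad : ∀ {p q} → p ∈ W → q ∈ W → ¬ Bad p q
    ¬bad p∈W q∈W (inj₁ (i<j , _)) = <-irrefl (trans (label p∈W) (sym (label q∈W))) i<j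
    ¬bad p∈W q∈W (inj₂ (j<i , _)) = <-irrefl (trans (label q∈W) (sym (label p∈W))) j<i
    none : bad W W ≡ 0
    none = n≤0⇒n≡0 (≤-trans (≤-reflexive (sym (+-identityʳ _))) (≤-trans
      (∑≤length* 1 W (λ {p} p∈W → ≤-reflexive (trans (+-identityʳ _)
        (cong length (filter-none (Bad? p) (All.tabulate (¬bad p∈W)))))))
      (≤-reflexive (*-zeroʳ (length W)))))

  layers-++ : ∀ {D m o o₁ o₂ r A B} → Disjoint T A B →
              (o₁ ≡ o × o₂ ≡ o + 2 ^ r) ⊎ (o₁ ≡ o + 2 ^ r × o₂ ≡ o) →
              (L₁ : Layers D m o₁ r A) (L₂ : Layers D m o₂ r B) →
              (let open Layers in ∀ {p} → p ∈ W L₂ → D * count (Bad? p) (W L₁) ≤ 2 * length (W L₁)) →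
              Layers D m o (suc r) (A ++ B)
  layers-++ {D} {m} {o} {o₁} {o₂} {r} {A} {B} dis sides L₁ L₂ sparse = record
    { W        = U ++ Z
    ; W⊆X      = [ ∈-++⁺ˡ ∘ L₁.W⊆X , ∈-++⁺ʳ A ∘ L₂.W⊆X ]′ ∘ ∈-++⁻ U
    ; lo       = [ ≤-trans o≤o₁ ∘ L₁.lo , ≤-trans o≤o₂ ∘ L₂.lo ]′ ∘ ∈-++⁻ U
    ; hi       = [ (λ p∈ → ≤-trans (L₁.hi p∈) (≤-trans (+-monoˡ-≤ (2 ^ r) o₁≤) (≤-reflexive top)))
                 , (λ p∈ → ≤-trans (L₂.hi p∈) (≤-trans (+-monoˡ-≤ (2 ^ r) o₂≤) (≤-reflexive top))) ]′
                 ∘ ∈-++⁻ U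
    ; distinct = AllPairs.++⁺ L₁.distinct L₂.distinct (All.tabulate λ u∈U → All.tabulate λ z∈Z eq →
                   dis (L₁.W⊆X u∈U) (subst (_∈ B) (sym eq) (L₂.W⊆X z∈Z)))
    ; size     = ≤-trans (≤-reflexive (length-++ U)) (≤-trans (+-mono-≤ L₁.size L₂.size)
                   (≤-reflexive (double (2 ^ r) m)))
    ; layers   = λ {i} o≤i i<top → subst (m ≤_) (sym (count-++ (label? i) U))
                   (full o≤i (subst (i <_) (sym top) i<top))
    ; few      = begin
        D * bad (U ++ Z) (U ++ Z)                             ≡⟨ cong (D *_) (bad-++ U Z) ⟩
        D * (bad U U + bad Z Z + 2 * bad Z U)                 ≡⟨ distr D (bad U U) (bad Z Z) (bad Z U) ⟩
        D * bad U U + D * bad Z Z + 2 * (D * bad Z U)         ≤⟨ +-mono-≤ (+-mono-≤ L₁.few L₂.few)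
                                                                  (*-monoʳ-≤ 2 cross) ⟩
        2 * (M * M) + 2 * (M * M) + 2 * (M * (2 * M))         ≡⟨ quadruple (2 ^ r) m ⟩
        2 * ((2 ^ suc r * m) * (2 ^ suc r * m))               ∎
    }
    where
    open ≤-Reasoning
    module L₁ = Layers L₁
    module L₂ = Layers L₂
    U = L₁.W
    Z = L₂.W
    M = 2 ^ r * m
    distr : ∀ d a b c → d * (a + b + 2 * c) ≡ d * a + d * b + 2 * (d * c)
    distr = solve-∀
    double : ∀ e m → e * m + e * m ≡ 2 * e * m
    double = solve-∀
    quadruple : ∀ e m → 2 * ((e * m) * (e * m)) + 2 * ((e * m) * (e * m)) + 2 * ((e * m) * (2 * (e * m)))
                      ≡ 2 * ((2 * e * m) * (2 * e * m))
    quadruple = solve-∀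
    top : o + 2 ^ r + 2 ^ r ≡ o + 2 ^ suc r
    top = lemma o (2 ^ r)
      where
      lemma : ∀ o e → o + e + e ≡ o + 2 * e
      lemma = solve-∀
    cross : D * bad Z U ≤ M * (2 * M)
    cross = ≤-trans (∑≤length* D Z (λ z∈Z → ≤-trans (sparse z∈Z) (*-monoʳ-≤ 2 L₁.size)))
                    (*-monoˡ-≤ (2 * M) L₂.size)
    o≤o₁ : o ≤ o₁
    o≤o₁ = [ (λ { (refl , _) → ≤-refl }) , (λ { (refl , _) → m≤m+n o _ }) ]′ sides
    o≤o₂ : o ≤ o₂
    o≤o₂ = [ (λ { (_ , refl) → m≤m+n o _ }) , (λ { (_ , refl) → ≤-refl }) ]′ sides
    o₁≤ : o₁ ≤ o + 2 ^ r
    o₁≤ = [ (λ { (refl , _) → m≤m+n o _ }) , (λ { (refl , _) → ≤-refl }) ]′ sides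
    o₂≤ : o₂ ≤ o + 2 ^ r
    o₂≤ = [ (λ { (_ , refl) → ≤-refl }) , (λ { (_ , refl) → m≤m+n o _ }) ]′ sides
    in-U : ∀ {i o′} → o₁ ≡ o′ → o′ ≤ i → i < o′ + 2 ^ r → m ≤ length (layer i U) + length (layer i Z)
    in-U refl o≤i i< = ≤-trans (L₁.layers o≤i i<) (m≤m+n _ _)
    in-Z : ∀ {i o′} → o₂ ≡ o′ → o′ ≤ i → i < o′ + 2 ^ r → m ≤ length (layer i U) + length (layer i Z)
    in-Z refl o≤i i< = ≤-trans (L₂.layers o≤i i<) (m≤n+m _ _)
    full : ∀ {i} → o ≤ i → i < o + 2 ^ r + 2 ^ r → m ≤ length (layer i U) + length (layer i Z)
    full {i} o≤i i<top with i <? o + 2 ^ r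
    ... | yes i< = [ (λ (o₁≡ , _) → in-U o₁≡ o≤i i<) , (λ (_ , o₂≡) → in-Z o₂≡ o≤i i<) ]′ sides
    ... | no i≮  = [ (λ (_ , o₂≡) → in-Z o₂≡ (≮⇒≥ i≮) i<top) , (λ (o₁≡ , _) → in-U o₁≡ (≮⇒≥ i≮) i<top) ]′ sides

  -- By double counting and Markov's inequality.
  module _ (ρ : V → V → Set) (ρ? : ∀ x y → Dec (ρ x y)) (D : ℕ) (U : List Labelled) (B : List V)
           (nearly : ∀ {u} → u ∈ U → D * count (λ b → ¬? (ρ? (proj₂ u) b)) B ≤ length B) where

    Sparse? : Decidable (λ b → D * count (λ u → ¬? (ρ? (proj₂ u) b)) U ≤ 2 * length U)
    Sparse? b = D * count (λ u → ¬? (ρ? (proj₂ u) b)) U ≤? 2 * length U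

    half-sparse : .{{_ : NonZero (length U)}} → length B ≤ 2 * count Sparse? B
    half-sparse = +-cancelʳ-≤ (length B) _ _ (begin
      length B + length B                                        ≡⟨ cong₂ _+_ (count-complement Sparse? B) (count-complement Sparse? B) ⟨
      (count Sparse? B + dense) + (count Sparse? B + dense)      ≡⟨ lemma (count Sparse? B) dense ⟩
      2 * count Sparse? B + 2 * dense                            ≤⟨ +-monoʳ-≤ (2 * count Sparse? B) few-dense ⟩
      2 * count Sparse? B + length B                             ∎)
      where
      open ≤-Reasoning
      dense = count (¬? ∘ Sparse?) B
      lemma : ∀ a b → (a + b) + (a + b) ≡ 2 * a + 2 * b
      lemma = solve-∀
      lemma′ : ∀ a b → a * (2 * b) ≡ 2 * a * b
      lemma′ = solve-∀
      ∑-* : ∀ (f : V → ℕ) xs → ∑ (λ x → D * f x) xs ≡ D * ∑ f xs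
      ∑-* f [] = sym (*-zeroʳ D)
      ∑-* f (x ∷ xs) = trans (cong (D * f x +_) (∑-* f xs)) (sym (*-distribˡ-+ D (f x) _))
      few-dense : 2 * dense ≤ length B
      few-dense = *-cancelˡ-≤ (length U) (begin
        length U * (2 * dense)                                       ≡⟨ lemma′ (length U) dense ⟩
        2 * length U * dense                                         ≤⟨ markov Sparse? (2 * length U) (λ b ¬s → <⇒≤ (≰⇒> ¬s)) B ⟩
        ∑ (λ b → D * count (λ u → ¬? (ρ? (proj₂ u) b)) U) B          ≡⟨ ∑-* _ B ⟩
        D * ∑ (λ b → count (λ u → ¬? (ρ? (proj₂ u) b)) U) B          ≡⟨ cong (D *_) (double-counting (λ u b → ¬? (ρ? (proj₂ u) b)) U B) ⟨
        D * ∑ (λ u → count (λ b → ¬? (ρ? (proj₂ u) b)) B) U          ≤⟨ ∑≤length* D U nearly ⟩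
        length U * length B                                          ∎)

  module _ (D m k : ℕ) .{{_ : NonZero D}} .{{_ : NonZero m}} (free : (P k -Free) T) where

    N : ℕ → ℕ
    N r = (8 * D ^ k) ^ r * m

    N≢0 : ∀ r → NonZero (N r)
    N≢0 r = m*n≢0 _ m {{m^n≢0 _ r {{m*n≢0 8 _ {{_}} {{m^n≢0 D k}}}}}}

    nearlyComplete : ∀ s .{{_ : NonZero s}} {X} → Unique X → 4 * s * D ^ k ≤ length X → NearlyComplete T D s X
    nearlyComplete s {X} uX 4sD≤X = [ (λ (x , ys , _ , _ , path , len) →
      contradiction free (IsPath⇒¬free T path (≤-trans (≤-reflexive (sym len)) (n≤1+n _)))) , id ]′
      (path-or-nearlyComplete T D s X k
        (Unique.take⁺ (2 * s) uX) (Unique.drop⁺ (2 * s) uX) (∈-take (2 * s)) (∈-drop (2 * s))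
        (unique⇒take-drop-disjoint (2 * s) uX)
        (≤-reflexive (sym (trans (length-take (2 * s) X) (m≤n⇒m⊓n≡m (≤-trans 2s≤2sD (≤-trans (m≤m+n _ _) 2*2sD≤X))))))
        (≤-trans (+-cancelˡ-≤ (2 * s) _ _ (≤-trans (+-monoˡ-≤ _ 2s≤2sD)
          (≤-trans 2*2sD≤X (m≤n+m∸n (length X) (2 * s))))) (≤-reflexive (sym (length-drop (2 * s) X)))))
      where
      2s≤2sD : 2 * s ≤ 2 * s * D ^ k
      2s≤2sD = m≤m*n (2 * s) (D ^ k) {{m^n≢0 D k}}
      2*2sD≤X : 2 * s * D ^ k + 2 * s * D ^ k ≤ length X
      2*2sD≤X = ≤-trans (≤-reflexive (lemma s (D ^ k))) 4sD≤X
        where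
        lemma : ∀ s e → 2 * s * e + 2 * s * e ≡ 4 * s * e
        lemma = solve-∀

    layers-exist : ∀ r o {X} → Unique X → N r ≤ length X → Layers D m o r X
    layers-exist zero o uX m≤X = layers-zero uX (≤-trans (≤-reflexive (sym (+-identityʳ m))) m≤X)
    layers-exist (suc r) o {X} uX N≤X = by-side nearly
      where
      s = 2 * N r
      instance
        s≢0 : NonZero s
        s≢0 = m*n≢0 2 (N r) {{_}} {{N≢0 r}}
      4sD≤X : 4 * s * D ^ k ≤ length X
      4sD≤X = ≤-trans (≤-reflexive (lemma (D ^ k) ((8 * D ^ k) ^ r) m)) N≤X
        where
        lemma : ∀ d e m → 4 * (2 * (e * m)) * d ≡ 8 * d * e * m
        lemma = solve-∀
      open NearlyComplete (nearlyComplete s uX 4sD≤X)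
      N≤s : N r ≤ s
      N≤s = m≤n*m (N r) 2
      bad-earlier : ∀ {i x j y} → i < j → Bad (j , y) (i , x) → ¬ (x ⟶ y)
      bad-earlier i<j (inj₁ (j<i , _)) = contradiction i<j (<-asym j<i)
      bad-earlier i<j (inj₂ (_ , ¬x⟶y)) = ¬x⟶y
      bad-later : ∀ {i x j y} → j < i → Bad (j , y) (i , x) → ¬ (y ⟶ x)
      bad-later j<i (inj₁ (_ , ¬y⟶x)) = ¬y⟶x
      bad-later j<i (inj₂ (i<j , _)) = contradiction j<i (<-asym i<j)
      join : ∀ o₁ o₂ (ρ : V → V → Set) (ρ? : ∀ x y → Dec (ρ x y)) →
        (∀ {a} → a ∈ A → D * count (λ b → ¬? (ρ? a b)) B ≤ length B) →
        (o₁ ≡ o × o₂ ≡ o + 2 ^ r) ⊎ (o₁ ≡ o + 2 ^ r × o₂ ≡ o) →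
        (∀ {i x j y} → o₁ ≤ i × i < o₁ + 2 ^ r → o₂ ≤ j × j < o₂ + 2 ^ r →
          Bad (j , y) (i , x) → ¬ ρ x y) →
        Layers D m o (suc r) X
      join o₁ o₂ ρ ρ? near sides bad⇒¬ρ =
        layers-widen ([ A⊆X , B⊆X ∘ proj₁ ∘ ∈-filter⁻ sparse? ]′ ∘ ∈-++⁻ A)
          (layers-++ (λ v∈A v∈B′ → disjoint v∈A (proj₁ (∈-filter⁻ sparse? v∈B′))) sides L₁ L₂ λ {p} p∈W →
            ≤-trans (*-monoʳ-≤ D (count-mono (Bad? p) (λ u → ¬? (ρ? (proj₂ u) (proj₂ p))) L₁.W λ u∈W →
                      bad⇒¬ρ (L₁.lo u∈W , L₁.hi u∈W) (Layers.lo L₂ p∈W , Layers.hi L₂ p∈W)))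
                    (proj₂ (∈-filter⁻ sparse? {xs = B} (Layers.W⊆X L₂ p∈W))))
        where
        L₁ : Layers D m o₁ r A
        L₁ = layers-exist r o₁ A-unique (≤-trans N≤s s≤∣A∣)
        module L₁ = Layers L₁
        near′ : ∀ {u} → u ∈ L₁.W → D * count (λ b → ¬? (ρ? (proj₂ u) b)) B ≤ length B
        near′ = near ∘ L₁.W⊆X
        sparse? = Sparse? ρ ρ? D L₁.W B near′
        ∣U∣≢0 : NonZero (length L₁.W)
        ∣U∣≢0 = >-nonZero (≤-trans (>-nonZero⁻¹ m) (≤-trans
          (L₁.layers ≤-refl (m<m+n o₁ (m^n>0 2 r))) (length-filter (label? o₁) L₁.W)))
        L₂ : Layers D m o₂ r (filter sparse? B)
        L₂ = layers-exist r o₂ (Unique.filter⁺ sparse? B-unique)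
          (*-cancelˡ-≤ 2 (≤-trans s≤∣B∣ (half-sparse ρ ρ? D L₁.W B near′ {{∣U∣≢0}})))
      by-side : (∀ {a} → a ∈ A → D * length (non-out T a B) ≤ length B) ⊎
                (∀ {a} → a ∈ A → D * length (non-in T a B) ≤ length B) → Layers D m o (suc r) X
      by-side (inj₁ near) = join o (o + 2 ^ r) _⟶_ _⟶?_ near (inj₁ (refl , refl))
        (λ (_ , i<) (o₂≤j , _) → bad-earlier (≤-trans i< o₂≤j))
      by-side (inj₂ near) = join (o + 2 ^ r) o (λ x y → y ⟶ x) (λ x y → y ⟶? x) near (inj₂ (refl , refl))
        (λ (o₁≤i , _) (_ , j<) → bad-later (≤-trans j< o₁≤i))

-- Complete pairs

module _ {n} (T : Tournament n) where
  open TournamentProperties T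

  private
    V = Fin n

  record CompletePair (z : ℕ) (X : List V) : Set where
    field
      A B      : List V
      A-unique : Unique A
      B-unique : Unique B
      A⊆X      : ∀ {v} → v ∈ A → v ∈ X
      B⊆X      : ∀ {v} → v ∈ B → v ∈ X
      z≤∣A∣    : z ≤ length A
      z≤∣B∣    : z ≤ length B
      complete : ∀ {a b} → a ∈ A → b ∈ B → a ⟶ b

  distinct⇒injective : ∀ {W : List (Labelled T)} → AllPairs (_≢_ on proj₂) W → ∀ {p q} → p ∈ W → q ∈ W →
                       proj₂ p ≡ proj₂ q → p ≡ q
  distinct⇒injective (d ∷ ds) (here refl) (here refl) eq = refl
  distinct⇒injective (d ∷ ds) (here refl) (there q∈) eq = contradiction eq (All.lookup d q∈)
  distinct⇒injective (d ∷ ds) (there p∈) (here refl) eq = contradiction (sym eq) (All.lookup d p∈)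
  distinct⇒injective (d ∷ ds) (there p∈) (there q∈) eq = distinct⇒injective ds p∈ q∈ eq

  data Zigzag (t : ℕ) : List (Labelled T) → Set where
    []  : Zigzag t []
    _∷_ : ∀ {p ps} → proj₁ p ≡ 2 * t → All (λ p′ → 2 + 2 * t ≤ proj₁ p′) ps → Zigzag t (p ∷ ps)

  module _ (z : ℕ) (X : List V) where

    -- The path is a₀ b₀ a₁ b₁ … with a_t in layer 2t and b_t in layer 2t + 3: the consecutive
    -- pairs a_{t+1} , b_t point forward along the layers, so that only the pairs a_t , b_t have
    -- to point backward, and these form a matching.
    zigzag : ∀ q t G → AllPairs (_≢_ on proj₂) G → (∀ {p} → p ∈ G → proj₂ p ∈ X) →
             (∀ {p} → p ∈ G → count (Bad? T p) G ≤ z) →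
             (∀ i → i < 2 * (t + q) + 2 → z * (1 + 2 * q) ≤ length (layer T i G)) →
             (∃[ ps ] (∀ {p} → p ∈ ps → p ∈ G) × IsPath T (map proj₂ ps) × length ps ≡ 2 * q × Zigzag t ps) ⊎
             CompletePair z X
    zigzag zero t G _ _ _ _ = inj₁ ([] , (λ ()) , [] , refl , [])
    zigzag (suc q) t G dis G⊆X sparse full with
      any? (λ a → any? (λ b → ¬? (proj₂ a ⟶? proj₂ b)) (layer T (3 + 2 * t) G)) (layer T (2 * t) G)
    ... | no ¬backward = inj₂ (record
      { A = map proj₂ La ; B = map proj₂ Lb
      ; A-unique = AllPairs.map⁺ (AllPairs.filter⁺ (label? T _) dis)
      ; B-unique = AllPairs.map⁺ (AllPairs.filter⁺ (label? T _) dis)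
      ; A⊆X = map⊆X ; B⊆X = map⊆X
      ; z≤∣A∣ = large 0 z≤n
      ; z≤∣B∣ = large 3 (s≤s (s≤s (s≤s z≤n)))
      ; complete = complete
      })
      where
      La = layer T (2 * t) G
      Lb = layer T (3 + 2 * t) G
      map⊆X : ∀ {i v} → v ∈ map proj₂ (layer T i G) → v ∈ X
      map⊆X {i} v∈ = let (p , p∈ , eq) = ∈-map⁻ proj₂ v∈ in
        subst (_∈ X) (sym eq) (G⊆X (proj₁ (∈-filter⁻ (label? T i) p∈)))
      large : ∀ c → c ≤ 3 → z ≤ length (map proj₂ (layer T (c + 2 * t) G))
      large c c≤3 = ≤-trans (m≤m*n z (1 + 2 * suc q)) (≤-trans
        (full (c + 2 * t) (≤-trans (s≤s (+-monoˡ-≤ (2 * t) c≤3))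
          (≤-trans (m≤m+n (4 + 2 * t) (2 * q)) (≤-reflexive (lemma t q)))))
        (≤-reflexive (sym (length-map proj₂ (layer T (c + 2 * t) G)))))
        where
        lemma : ∀ t q → 4 + 2 * t + 2 * q ≡ 2 * (t + (1 + q)) + 2
        lemma = solve-∀
      complete : ∀ {x y} → x ∈ map proj₂ La → y ∈ map proj₂ Lb → x ⟶ y
      complete x∈ y∈ =
        let (a , a∈ , x≡) = ∈-map⁻ proj₂ x∈
            (b , b∈ , y≡) = ∈-map⁻ proj₂ y∈
        in subst₂ _⟶_ (sym x≡) (sym y≡) (decidable-stable (proj₂ a ⟶? proj₂ b)
             (λ ¬a⟶b → ¬backward (lose a∈ (lose b∈ ¬a⟶b))))
    ... | yes backward = let (a , a∈ , any-b) = find backward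
                             (b , b∈ , ¬a⟶b) = find any-b
                         in step a b (∈-filter⁻ (label? T _) a∈) (∈-filter⁻ (label? T _) b∈) ¬a⟶b
      where
      step : ∀ a b → a ∈ G × proj₁ a ≡ 2 * t → b ∈ G × proj₁ b ≡ 3 + 2 * t → ¬ (proj₂ a ⟶ proj₂ b) → _
      step a b (a∈G , a-label) (b∈G , b-label) ¬a⟶b =
        [ inj₁ ∘ prepend , inj₂ ]′ (zigzag q (suc t) G′
          (AllPairs.filter⁺ _ (AllPairs.filter⁺ _ dis)) (G⊆X ∘ G′⊆G) sparse′ full′)
        where
        ok-a? = ¬? ∘ Bad? T a
        ok-b? = ¬? ∘ Bad? T b
        G₁ = filter ok-a? G
        G′ = filter ok-b? G₁
        G′⊆G : ∀ {p} → p ∈ G′ → p ∈ G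
        G′⊆G p∈ = proj₁ (∈-filter⁻ ok-a? {xs = G} (proj₁ (∈-filter⁻ ok-b? {xs = G₁} p∈)))
        ok-a : ∀ {p} → p ∈ G′ → ¬ Bad T a p
        ok-a p∈ = proj₂ (∈-filter⁻ ok-a? {xs = G} (proj₁ (∈-filter⁻ ok-b? {xs = G₁} p∈)))
        ok-b : ∀ {p} → p ∈ G′ → ¬ Bad T b p
        ok-b p∈ = proj₂ (∈-filter⁻ ok-b? {xs = G₁} p∈)
        sparse′ : ∀ {p} → p ∈ G′ → count (Bad? T p) G′ ≤ z
        sparse′ {p} p∈ = ≤-trans (count-filter-≤ (Bad? T p) ok-b? G₁)
          (≤-trans (count-filter-≤ (Bad? T p) ok-a? G) (sparse (G′⊆G p∈)))
        lost : ∀ p H → count (Bad? T p) H ≤ z → count (¬? ∘ ¬? ∘ Bad? T p) H ≤ z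
        lost p H = ≤-trans (count-mono (¬? ∘ ¬? ∘ Bad? T p) (Bad? T p) H λ _ → decidable-stable (Bad? T p _))
        full′ : ∀ i → i < 2 * (suc t + q) + 2 → z * (1 + 2 * q) ≤ length (layer T i G′)
        full′ i i< = +-cancelʳ-≤ (z + z) _ _ (begin
          z * (1 + 2 * q) + (z + z)             ≡⟨ lemma z q ⟩
          z * (1 + 2 * (1 + q))                 ≤⟨ full i (subst (λ s → i < 2 * s + 2) (sym (+-suc t q)) i<) ⟩
          count (label? T i) G                  ≤⟨ count≤count-filter+ (label? T i) ok-a? G ⟩
          count (label? T i) G₁ + _             ≤⟨ +-mono-≤ (count≤count-filter+ (label? T i) ok-b? G₁) (lost a G (sparse a∈G)) ⟩
          count (label? T i) G′ + _ + z         ≤⟨ +-monoˡ-≤ z (+-monoʳ-≤ (count (label? T i) G′) (lost b G₁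
                                                     (≤-trans (count-filter-≤ (Bad? T b) ok-a? G) (sparse b∈G)))) ⟩
          count (label? T i) G′ + z + z         ≡⟨ +-assoc _ z z ⟩
          count (label? T i) G′ + (z + z)       ∎)
          where
          open ≤-Reasoning
          lemma : ∀ z q → z * (1 + 2 * q) + (z + z) ≡ z * (1 + 2 * (1 + q))
          lemma = solve-∀
        a<b : proj₁ a < proj₁ b
        a<b = subst₂ _<_ (sym a-label) (sym b-label) (s≤s (m≤n+m (2 * t) 2))
        b⟶a : proj₂ b ⟶ proj₂ a
        b⟶a = ⟶-flip (λ eq → <⇒≢ a<b (cong proj₁ (distinct⇒injective dis a∈G b∈G eq))) ¬a⟶b
        2+2t≡ : 2 * suc t ≡ 2 + 2 * t
        2+2t≡ = *-suc 2 t
        prepend : _ → _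
        prepend (ps , ps⊆G′ , path , len , zz) =
          a ∷ b ∷ ps ,
          (λ { (here refl) → a∈G ; (there (here refl)) → b∈G ; (there (there p∈)) → G′⊆G (ps⊆G′ p∈) }) ,
          extend ps⊆G′ path zz ,
          trans (cong (2 +_) len) (sym (*-suc 2 q)) ,
          a-label ∷ (subst (2 + 2 * t ≤_) (sym b-label) (n≤1+n _) ∷ later zz)
          where
          later : ∀ {ps} → Zigzag (suc t) ps → All (λ p → 2 + 2 * t ≤ proj₁ p) ps
          later [] = []
          later (eq ∷ geq) = ≤-reflexive (sym (trans eq 2+2t≡)) ∷
            All.map (≤-trans (≤-trans (≤-reflexive (sym 2+2t≡)) (m≤n+m (2 * suc t) 2))) geq
          a⟶ : ∀ {p} → p ∈ G′ → 2 + 2 * t ≤ proj₁ p → proj₂ a ⟶ proj₂ p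
          a⟶ p∈ ≤p = good⇒⟶ T (ok-a p∈) (subst (_< _) (sym a-label) (≤-trans (n≤1+n _) ≤p))
          b⟶ : ∀ {p} → p ∈ G′ → 2 + 2 * suc t ≤ proj₁ p → proj₂ b ⟶ proj₂ p
          b⟶ p∈ ≤p = good⇒⟶ T (ok-b p∈) (subst (_< _) (sym b-label)
            (≤-trans (≤-reflexive (cong (2 +_) (sym 2+2t≡))) ≤p))
          ⟶b : ∀ {p} → p ∈ G′ → proj₁ p ≡ 2 * suc t → proj₂ p ⟶ proj₂ b
          ⟶b p∈ eq = good⇒⟶ T (ok-b p∈ ∘ swap) (≤-reflexive (trans (cong suc (trans eq 2+2t≡)) (sym b-label)))
          extend : ∀ {ps} → (∀ {p} → p ∈ ps → p ∈ G′) → IsPath T (map proj₂ ps) → Zigzag (suc t) ps →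
                   IsPath T (map proj₂ (a ∷ b ∷ ps))
          extend {[]} _ _ _ = link b⟶a [] [-]
          extend {c ∷ cs} ⊆G′ path zz@(c-label ∷ ≤cs) = link b⟶a
            (All.map⁺ (All.tabulate (λ p∈ → a⟶ (⊆G′ p∈) (All.lookup (later zz) p∈))))
            (link (⟶b (⊆G′ (here refl)) c-label)
              (All.map⁺ (All.tabulate (λ p∈ → b⟶ (⊆G′ (there p∈)) (All.lookup ≤cs p∈)))) path)

  -- K and D are variables, because the products of numerals are too large when unfolded.
  module _ (k r K D : ℕ) (K≡ : K ≡ 2 ^ r) (D≡ : D ≡ 32 * (K * K * K)) (2k+2≤K : 2 * k + 2 ≤ K)
           (free : (P k -Free) T) where

    M = (8 * D ^ k) ^ r * (4 * K)

    private instance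
      K≢0 : NonZero K
      K≢0 = subst NonZero (sym K≡) (m^n≢0 2 r)
      D≢0 : NonZero D
      D≢0 = subst NonZero (sym D≡) (m*n≢0 32 (K * K * K) {{_}} {{m*n≢0 (K * K) K {{m*n≢0 K K}}}})

    completePair : ∀ z .{{_ : NonZero z}} {X} → Unique X → M * z ≤ length X → CompletePair z X
    completePair z {X} uX Mz≤X = [ (λ (ps , _ , path , len , _) →
        contradiction free (IsPath⇒¬free T path (≤-trans (m≤n*m k 2)
          (≤-reflexive (sym (trans (length-map proj₂ ps) len)))))) , id ]′
      (zigzag z X k 0 G (AllPairs.filter⁺ _ L.distinct) (L.W⊆X ∘ proj₁ ∘ ∈-filter⁻ good?)
        (λ {p} p∈G → ≤-trans (count-filter-≤ (Bad? T p) good? L.W) (proj₂ (∈-filter⁻ good? {xs = L.W} p∈G)))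
        (λ i i< → ≤-trans (small i) (+-cancelʳ-≤ (K * z) (3 * K * z) _ (enough i (≤-trans i< 2k+2≤K)))))
      where
      m = 4 * K * z
      L : Layers T D m 0 r X
      L = layers-exist T D m k {{D≢0}} {{m*n≢0 (4 * K) z {{m*n≢0 4 K}}}} free r 0 uX
            (≤-trans (≤-reflexive (sym (*-assoc ((8 * D ^ k) ^ r) (4 * K) z))) Mz≤X)
      module L = Layers L
      good? = λ p → count (Bad? T p) L.W ≤? z
      G = filter good? L.W
      few-bad : count (¬? ∘ good?) L.W ≤ K * z
      few-bad = *-cancelˡ-≤ z (≤-trans (markov good? z (λ p ¬good → <⇒≤ (≰⇒> ¬good)) L.W)
        (*-cancelˡ-≤ D (≤-trans L.few few≤)))
        where
        lemma : ∀ a b K z → a * ((K * (b * K * z)) * (K * (b * K * z))) ≡ a * b * b * (K * K * K) * (z * (K * z))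
        lemma = solve-∀
        few≤ : 2 * ((2 ^ r * m) * (2 ^ r * m)) ≤ D * (z * (K * z))
        few≤ = ≤-reflexive (trans (cong (λ e → 2 * ((e * m) * (e * m))) (sym K≡))
                 (trans (lemma 2 4 K z) (cong (_* (z * (K * z))) (sym D≡))))
      small : ∀ i → z * (1 + 2 * k) ≤ 3 * K * z
      small i = ≤-trans (*-monoʳ-≤ z (≤-trans (≤-trans (n≤1+n _) (≤-reflexive (+-comm 2 (2 * k)))) 2k+2≤K))
        (≤-trans (≤-reflexive (*-comm z K)) (*-monoˡ-≤ z (m≤n*m K 3)))
      enough : ∀ i → i < K → 3 * K * z + K * z ≤ length (layer T i G) + K * z
      enough i i<K = begin
        3 * K * z + K * z                                          ≡⟨ lemma K z ⟩
        m                                                                ≤⟨ L.layers z≤n (subst (i <_) K≡ i<K) ⟩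
        count (label? T i) L.W                                           ≤⟨ count≤count-filter+ (label? T i) good? L.W ⟩
        count (label? T i) G + count (¬? ∘ good?) L.W                    ≤⟨ +-monoʳ-≤ (count (label? T i) G) few-bad ⟩
        count (label? T i) G + K * z                                     ∎
        where
        open ≤-Reasoning
        lemma : ∀ K z → 3 * K * z + K * z ≡ 4 * K * z
        lemma = solve-∀

  module _ (M : ℕ) .{{_ : NonZero M}}
           (pair : ∀ z .{{_ : NonZero z}} {X} → Unique X → M * z ≤ length X → CompletePair z X) where

    transitive-list : ∀ d {X} → Unique X → M ^ d * 2 ≤ length X →
                      ∃[ ys ] (∀ {y} → y ∈ ys → y ∈ X) × AllPairs _⟶_ ys × 2 ^ suc d ≤ length ys
    transitive-list zero {x ∷ y ∷ X} ((x≢y ∷ _) ∷ _) _ with x ⟶? y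
    ... | yes x⟶y = x ∷ y ∷ [] , (λ { (here eq) → here eq ; (there (here eq)) → there (here eq) }) ,
                    ((x⟶y ∷ []) ∷ [] ∷ []) , ≤-refl
    ... | no ¬x⟶y = y ∷ x ∷ [] , (λ { (here eq) → there (here eq) ; (there (here eq)) → here eq }) ,
                    ((⟶-flip x≢y ¬x⟶y ∷ []) ∷ [] ∷ []) , ≤-refl
    transitive-list zero {_ ∷ []} _ (s≤s ())
    transitive-list (suc d) {X} uX M≤X =
      let open CompletePair (pair (M ^ d * 2) {{m*n≢0 (M ^ d) 2 {{m^n≢0 M d}}}} uX
                               (≤-trans (≤-reflexive (sym (*-assoc M (M ^ d) 2))) M≤X))
          (ys , ys⊆A , ys⟶ , ≤ys) = transitive-list d A-unique z≤∣A∣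
          (zs , zs⊆B , zs⟶ , ≤zs) = transitive-list d B-unique z≤∣B∣
      in ys ++ zs , [ A⊆X ∘ ys⊆A , B⊆X ∘ zs⊆B ]′ ∘ ∈-++⁻ ys ,
         AllPairs.++⁺ ys⟶ zs⟶ (All.tabulate λ y∈ → All.tabulate λ z∈ → complete (ys⊆A y∈) (zs⊆B z∈)) ,
         ≤-trans (+-mono-≤ ≤ys (+-mono-≤ ≤zs z≤n)) (≤-reflexive (trans (cong (length ys +_) (+-identityʳ _)) (sym (length-++ ys))))

-- Transitive subtournaments

AllPairs-lookup : ∀ {A : Set} {R : A → A → Set} {xs} → AllPairs R xs →
                  ∀ {i j} → toℕ i < toℕ j → R (lookup xs i) (lookup xs j)
AllPairs-lookup (x∼xs ∷ _) {zero} {suc j} _ = All.lookup x∼xs (∈-lookup j)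
AllPairs-lookup (_ ∷ xs∼) {suc i} {suc j} (s≤s i<j) = AllPairs-lookup xs∼ i<j

unique⇒lookup-injective : ∀ {A : Set} {xs : List A} → Unique xs → ∀ {i j} → lookup xs i ≡ lookup xs j → i ≡ j
unique⇒lookup-injective u {i} {j} eq with <-cmp (toℕ i) (toℕ j)
... | tri< i<j _ _ = contradiction eq (AllPairs-lookup u i<j)
... | tri≈ _ i≡j _ = toℕ-injective i≡j
... | tri> _ _ j<i = contradiction (sym eq) (AllPairs-lookup u j<i)

unique⇒length≤ : ∀ {n} {xs : List (Fin n)} → Unique xs → length xs ≤ n
unique⇒length≤ u = injective⇒≤ (unique⇒lookup-injective u)

increasing⇒first≤last : ∀ {ℓ} (g : Fin (suc ℓ) → ℕ) → (∀ i → g (inject₁ i) < g (suc i)) →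
                        g zero ≤ g (fromℕ ℓ)
increasing⇒first≤last {zero}  g inc = ≤-refl
increasing⇒first≤last {suc ℓ} g inc =
  ≤-trans (<⇒≤ (inc zero)) (increasing⇒first≤last (g ∘ suc) (inc ∘ suc))

module _ {n} (T : Tournament n) where
  open TournamentProperties T

  ordered⇒unique : ∀ {xs} → AllPairs _⟶_ xs → Unique xs
  ordered⇒unique = AllPairs.map ⟶⇒≢

  ordered⇒transitive : ∀ {xs} → AllPairs _⟶_ xs →
                       Σ (Fin (length xs) ↣ Fin n) λ f → Transitive (T [ f ])
  ordered⇒transitive {xs} xs⟶ = f , λ c →
    let open DirectedCycle c
        to = Injection.to vertices
    in <⇒≱ (forward close) (increasing⇒first≤last (toℕ ∘ to) (forward ∘ step))
    where
    f = mk↣ (unique⇒lookup-injective (ordered⇒unique xs⟶))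
    forward : ∀ {i j} → lookup xs i ⟶ lookup xs j → toℕ i < toℕ j
    forward {i} {j} i⟶j with <-cmp (toℕ i) (toℕ j)
    ... | tri< i<j _ _ = i<j
    ... | tri≈ _ i≡j _ with refl ← toℕ-injective {i = i} {j} i≡j = contradiction i⟶j (loopless _)
    ... | tri> _ _ j<i = contradiction i⟶j (⟶-asym (AllPairs-lookup xs⟶ j<i))

  module _ (acyclic : Transitive T) where

    ⟶-trans : ∀ {u v w} → u ⟶ v → v ⟶ w → u ⟶ w
    ⟶-trans {u} {v} {w} u⟶v v⟶w with u ⟶? w
    ... | yes u⟶w = u⟶w
    ... | no ¬u⟶w = contradiction cycle acyclic
      where
      w⟶u : w ⟶ u
      w⟶u = ⟶-flip (λ { refl → ⟶-asym u⟶v v⟶w }) ¬u⟶w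
      g : Fin 3 → Fin n
      g zero             = u
      g (suc zero)       = v
      g (suc (suc zero)) = w
      g-injective : ∀ {i j} → g i ≡ g j → i ≡ j
      g-injective {zero} {zero} _ = refl
      g-injective {zero} {suc zero} eq = contradiction eq (⟶⇒≢ u⟶v)
      g-injective {zero} {suc (suc zero)} eq = contradiction (sym eq) (⟶⇒≢ w⟶u)
      g-injective {suc zero} {zero} eq = contradiction (sym eq) (⟶⇒≢ u⟶v)
      g-injective {suc zero} {suc zero} _ = refl
      g-injective {suc zero} {suc (suc zero)} eq = contradiction eq (⟶⇒≢ v⟶w)
      g-injective {suc (suc zero)} {zero} eq = contradiction eq (⟶⇒≢ w⟶u)
      g-injective {suc (suc zero)} {suc zero} eq = contradiction (sym eq) (⟶⇒≢ v⟶w)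
      g-injective {suc (suc zero)} {suc (suc zero)} _ = refl
      cycle : DirectedCycle T
      cycle = record
        { ℓ = 2 ; vertices = mk↣ g-injective
        ; step = λ { zero → u⟶v ; (suc zero) → v⟶w }
        ; close = w⟶u }

    insert : ∀ x ys → All (x ≢_) ys → AllPairs _⟶_ ys →
             ∃[ zs ] AllPairs _⟶_ zs × length zs ≡ suc (length ys) ×
                     (∀ {Q : Fin n → Set} → Q x → All Q ys → All Q zs)
    insert x [] _ _ = x ∷ [] , ([] ∷ []) , refl , λ Qx _ → Qx ∷ []
    insert x (y ∷ ys) (x≢y ∷ x≢ys) (y⟶ys ∷ ys⟶) with x ⟶? y
    ... | yes x⟶y = x ∷ y ∷ ys , ((x⟶y ∷ All.map (⟶-trans x⟶y) y⟶ys) ∷ y⟶ys ∷ ys⟶) , refl , _∷_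
    ... | no ¬x⟶y =
      let (zs , zs⟶ , len , keeps) = insert x ys x≢ys ys⟶
      in y ∷ zs , (keeps (⟶-flip x≢y ¬x⟶y) y⟶ys ∷ zs⟶) , cong suc len , λ { Qx (Qy ∷ Qys) → Qy ∷ keeps Qx Qys }

    sort : ∀ {xs} → Unique xs → ∃[ zs ] AllPairs _⟶_ zs × length zs ≡ length xs ×
                                        (∀ {Q : Fin n → Set} → All Q xs → All Q zs)
    sort [] = [] , [] , refl , id
    sort (x≢xs ∷ uxs) =
      let (ys , ys⟶ , len , keeps) = sort uxs
          (zs , zs⟶ , len′ , keeps′) = insert _ ys (keeps x≢xs) ys⟶
      in zs , zs⟶ , trans len′ (cong suc len) , λ { (Qx ∷ Qxs) → keeps′ Qx (keeps Qxs) }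

    transitive⇒ordered : ∃[ zs ] AllPairs _⟶_ zs × length zs ≡ n
    transitive⇒ordered =
      let (zs , zs⟶ , len , _) = sort (Unique.allFin⁺ n) in zs , zs⟶ , trans len (length-tabulate id)

sub-transitive⇒ordered : ∀ {m n} (T : Tournament n) (f : Fin m ↣ Fin n) → Transitive (T [ f ]) →
                         ∃[ zs ] AllPairs (Tournament._⟶_ T) zs × length zs ≡ m
sub-transitive⇒ordered T f tr =
  let (zs , zs⟶ , len) = transitive⇒ordered (T [ f ]) tr
      to = Injection.to f
  in map to zs , AllPairs.map⁺ zs⟶ , trans (length-map to zs) len

n<2^n : ∀ n → n < 2 ^ n
n<2^n zero    = s≤s z≤n
n<2^n (suc n) = ≤-trans (+-mono-≤ (m^n>0 2 n) (n<2^n n)) (≤-reflexive (cong (2 ^ n +_) (sym (+-identityʳ (2 ^ n)))))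

bracket : ∀ M n f → 2 ≤ n → n < M ^ f * 2 → ∃[ d ] M ^ d * 2 ≤ n × n < M ^ suc d * 2
bracket M n zero    2≤n n<2 = contradiction n<2 (≤⇒≯ 2≤n)
bracket M n (suc f) 2≤n n< with M ^ f * 2 ≤? n
... | yes ≤n = f , ≤n , n<
... | no ≰n  = bracket M n f 2≤n (≰⇒> ≰n)

module _ (k r : ℕ) where

  exponent : ℕ
  exponent = r * (3 + k * (5 + 3 * r)) + (2 + r)

  M≡2^exponent : ∀ K D → K ≡ 2 ^ r → D ≡ 2 ^ (5 + 3 * r) → (8 * D ^ k) ^ r * (4 * K) ≡ 2 ^ exponent
  M≡2^exponent K D refl refl = begin
    (8 * (2 ^ (5 + 3 * r)) ^ k) ^ r * (4 * 2 ^ r)     ≡⟨ cong (λ e → (8 * e) ^ r * (4 * 2 ^ r)) (^-*-assoc 2 (5 + 3 * r) k) ⟩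
    (2 ^ 3 * 2 ^ ((5 + 3 * r) * k)) ^ r * (2 ^ 2 * 2 ^ r)
      ≡⟨ cong₂ (λ e f → e ^ r * f) (^-distribˡ-+-* 2 3 ((5 + 3 * r) * k)) (^-distribˡ-+-* 2 2 r) ⟨
    (2 ^ (3 + (5 + 3 * r) * k)) ^ r * 2 ^ (2 + r)     ≡⟨ cong (_* 2 ^ (2 + r)) (^-*-assoc 2 (3 + (5 + 3 * r) * k) r) ⟩
    2 ^ ((3 + (5 + 3 * r) * k) * r) * 2 ^ (2 + r)     ≡⟨ ^-distribˡ-+-* 2 ((3 + (5 + 3 * r) * k) * r) (2 + r) ⟨
    2 ^ ((3 + (5 + 3 * r) * k) * r + (2 + r))         ≡⟨ cong (λ e → 2 ^ (e + (2 + r))) (trans (*-comm _ r) (cong (λ e → r * (3 + e)) (*-comm _ k))) ⟩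
    2 ^ exponent                                      ∎
    where open ≡-Reasoning

  D≡32K³ : ∀ K D → K ≡ 2 ^ r → D ≡ 2 ^ (5 + 3 * r) → D ≡ 32 * (K * K * K)
  D≡32K³ K D refl refl = trans (^-distribˡ-+-* 2 5 (3 * r)) (cong (32 *_) (trans
    (cong (2 ^_) (lemma r)) (trans (^-distribˡ-+-* 2 (r + r) r) (cong (_* 2 ^ r) (^-distribˡ-+-* 2 r r)))))
    where
    lemma : ∀ r → 3 * r ≡ r + r + r
    lemma = solve-∀

module _ {n} (T : Tournament n) (k r : ℕ) (2k+2≤2^r : 2 * k + 2 ≤ 2 ^ r) (free : (P k -Free) T) where
  open TournamentProperties T

  private
    ordered : ∀ K D → K ≡ 2 ^ r → D ≡ 2 ^ (5 + 3 * r) → ∀ M → M ≡ 2 ^ exponent k r →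
              ∀ d → M ^ d * 2 ≤ n → ∃[ ys ] AllPairs _⟶_ ys × 2 ^ suc d ≤ length ys
    ordered K D K≡ D≡ M M≡ d ≤n =
      let (ys , _ , ys⟶ , ≤ys) = transitive-list T M {{subst NonZero (sym M≡) (m^n≢0 2 (exponent k r))}}
            (λ z uX M≤X → completePair T k r K D K≡ (D≡32K³ k r K D K≡ D≡) (subst (2 * k + 2 ≤_) (sym K≡) 2k+2≤2^r)
               free z uX (subst (λ e → e * z ≤ _) (trans M≡ (sym (M≡2^exponent k r K D K≡ D≡))) M≤X))
            d (Unique.allFin⁺ n) (≤-trans ≤n (≤-reflexive (sym (length-tabulate id))))
      in ys , ys⟶ , ≤ys

  large-transitive : .{{_ : NonZero n}} →
    ∃[ m ] Σ (Fin m ↣ Fin n) λ f → Transitive (T [ f ]) × NonZero m × n ≤ m ^ suc (exponent k r)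
  large-transitive with 2 ≤? n
  ... | yes 2≤n =
    let μ = exponent k r
        (d , M≤n , n<M) = bracket (2 ^ μ) n n 2≤n (small n)
        (ys , ys⟶ , ≤ys) = ordered (2 ^ r) _ refl refl (2 ^ μ) refl d M≤n
        (f , tr) = ordered⇒transitive T ys⟶
    in length ys , f , tr , >-nonZero (≤-trans (m^n>0 2 (suc d)) ≤ys) , (begin
      n                              ≤⟨ <⇒≤ n<M ⟩
      (2 ^ μ) ^ suc d * 2            ≡⟨ cong (_* 2) (^-*-assoc 2 μ (suc d)) ⟩
      2 ^ (μ * suc d) * 2 ^ 1        ≡⟨ ^-distribˡ-+-* 2 (μ * suc d) 1 ⟨
      2 ^ (μ * suc d + 1)            ≤⟨ ^-monoʳ-≤ 2 (≤-trans (+-monoʳ-≤ (μ * suc d) (s≤s z≤n)) (≤-reflexive (lemma μ (suc d)))) ⟩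
      2 ^ (suc d * suc μ)            ≡⟨ ^-*-assoc 2 (suc d) (suc μ) ⟨
      (2 ^ suc d) ^ suc μ            ≤⟨ ^-monoˡ-≤ (suc μ) ≤ys ⟩
      length ys ^ suc μ              ∎)
    where
    open ≤-Reasoning
    lemma : ∀ μ e → μ * e + e ≡ e * (1 + μ)
    lemma = solve-∀
    small : ∀ f → f < (2 ^ exponent k r) ^ f * 2
    small f = ≤-trans (n<2^n f) (≤-trans (^-monoˡ-≤ f {2} (^-monoʳ-≤ 2 {1} {exponent k r} (≤-trans (s≤s z≤n) (m≤n+m (2 + r) _))))
      (m≤m*n _ 2))
  ... | no 2≰n = n , mk↣ id , acyclic , it , ≤-reflexive (sym (trans (cong (_^ suc (exponent k r)) n≡1) (trans (^-zeroˡ (suc (exponent k r))) (sym n≡1))))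
    where
    n≡1 : n ≡ 1
    n≡1 = ≤-antisym (s≤s⁻¹ (≰⇒> 2≰n)) (>-nonZero⁻¹ n)
    it = >-nonZero (>-nonZero⁻¹ n)
    acyclic : Transitive (T [ mk↣ id ])
    acyclic c = loopless _ (subst (to (fromℕ ℓ) ⟶_) (toℕ-injective (trans (is-0 (to zero)) (sym (is-0 (to (fromℕ ℓ)))))) close)
      where
      open DirectedCycle c
      open Injection vertices using (to)
      is-0 : (i : Fin n) → toℕ i ≡ 0
      is-0 i = n<1⇒n≡0 (subst (toℕ i <_) n≡1 (toℕ<n i))

-- Random tournaments

private
  _≟ᵐ_ = ≡-dec Bool._≟_

-- A clause forbids one partial assignment of M Boolean variables.
Clause : Set → Set
Clause V = V → Maybe Bool

free : ∀ {M} → Clause (Fin M) → ℕ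
free {zero}  c = 0
free {suc M} c = # (c zero ≟ᵐ nothing) + free (c ∘ suc)

add : {A : Set} → Bool → Maybe Bool → A → List A → List A
add true  (just false) c cs = cs
add false (just true)  c cs = cs
add _     _            c cs = c ∷ cs

restrict : ∀ {M} → Bool → List (Clause (Fin (suc M))) → List (Clause (Fin M))
restrict b []       = []
restrict b (c ∷ cs) = add b (c zero) (c ∘ suc) (restrict b cs)

∈-add-here : ∀ {A : Set} b m {c : A} {cs} → m ≢ just (not b) → c ∈ add b m c cs
∈-add-here true  (just true)  _ = here refl
∈-add-here true  (just false) m≢ = contradiction refl m≢
∈-add-here true  nothing      _ = here refl
∈-add-here false (just true)  m≢ = contradiction refl m≢
∈-add-here false (just false) _ = here refl
∈-add-here false nothing      _ = here refl

∈-add-there : ∀ {A : Set} b m {c d : A} {cs} → d ∈ cs → d ∈ add b m c cs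
∈-add-there true  (just true)  = there
∈-add-there true  (just false) = id
∈-add-there true  nothing      = there
∈-add-there false (just true)  = id
∈-add-there false (just false) = there
∈-add-there false nothing      = there

∈-restrict : ∀ {M} b {cs : List (Clause (Fin (suc M)))} {c} → c ∈ cs → c zero ≢ just (not b) → (c ∘ suc) ∈ restrict b cs
∈-restrict b {c ∷ cs} (here refl) c≢ = ∈-add-here b (c zero) c≢
∈-restrict b {c ∷ cs} (there c∈)  c≢ = ∈-add-there b (c zero) (∈-restrict b c∈ c≢)

weight : ∀ {M} → List (Clause (Fin M)) → ℕ
weight = ∑ (λ c → 2 ^ free c)

weight-add : ∀ {M} m (c : Clause (Fin M)) cs cs′ →
             weight (add true m c cs) + weight (add false m c cs′) ≡ 2 ^ (# (m ≟ᵐ nothing) + free c) + (weight cs + weight cs′)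
weight-add (just true)  c cs cs′ = +-assoc (2 ^ free c) (weight cs) (weight cs′)
weight-add (just false) c cs cs′ = lemma (weight cs) (2 ^ free c) (weight cs′)
  where
  lemma : ∀ a b c → a + (b + c) ≡ b + (a + c)
  lemma = solve-∀
weight-add nothing      c cs cs′ = lemma (2 ^ free c) (weight cs) (weight cs′)
  where
  lemma : ∀ a b c → a + b + (a + c) ≡ 2 * a + (b + c)
  lemma = solve-∀

weight-restrict : ∀ {M} (cs : List (Clause (Fin (suc M)))) →
                  weight (restrict true cs) + weight (restrict false cs) ≡ weight cs
weight-restrict [] = refl
weight-restrict (c ∷ cs) = trans (weight-add (c zero) (c ∘ suc) (restrict true cs) (restrict false cs))
                                 (cong (2 ^ free c +_) (weight-restrict cs))

-- The method of conditional expectations.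
satisfiable : ∀ M (cs : List (Clause (Fin M))) → weight cs < 2 ^ M →
              Σ (Fin M → Bool) λ σ → (∀ c → c ∈ cs → ∃[ e ] c e ≡ just (not (σ e)))
satisfiable zero []       _ = (λ ()) , λ _ ()
satisfiable zero (_ ∷ _) (s≤s ())
satisfiable (suc M) cs w< = by-cases (weight (restrict true cs) <? 2 ^ M)
  where
  assign : ∀ b → weight (restrict b cs) < 2 ^ M → Σ (Fin (suc M) → Bool) λ σ → (∀ c → c ∈ cs → ∃[ e ] c e ≡ just (not (σ e)))
  assign b wb< = σ′ , violated
    where
    rest : Σ (Fin M → Bool) λ σ → (∀ c → c ∈ restrict b cs → ∃[ e ] c e ≡ just (not (σ e)))
    rest = satisfiable M (restrict b cs) wb<
    σ′ : Fin (suc M) → Bool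
    σ′ zero    = b
    σ′ (suc e) = proj₁ rest e
    shift : ∀ {c : Clause (Fin (suc M))} → ∃[ e ] c (suc e) ≡ just (not (σ′ (suc e))) → ∃[ e ] c e ≡ just (not (σ′ e))
    shift (e , eq) = suc e , eq
    violated : ∀ c → c ∈ cs → ∃[ e ] c e ≡ just (not (σ′ e))
    violated c c∈cs with c zero ≟ᵐ just (not b)
    ... | yes eq = zero , eq
    ... | no neq = shift (proj₂ rest (c ∘ suc) (∈-restrict b c∈cs neq))
  by-cases : Dec (weight (restrict true cs) < 2 ^ M) → _
  by-cases (yes wt<) = assign true wt<
  by-cases (no wt≮)  = assign false (+-cancelˡ-< (2 ^ M) _ _ (begin-strict
    2 ^ M + weight (restrict false cs)                         ≤⟨ +-monoˡ-≤ _ (≮⇒≥ wt≮) ⟩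
    weight (restrict true cs) + weight (restrict false cs)     ≡⟨ weight-restrict cs ⟩
    weight cs                                                  <⟨ w< ⟩
    2 ^ suc M                                                  ≡⟨ cong (2 ^ M +_) (+-identityʳ (2 ^ M)) ⟩
    2 ^ M + 2 ^ M                                              ∎))
    where open ≤-Reasoning

free≡count : ∀ {A : Set} M (g : Fin M → A) (c : Clause A) →
             free (c ∘ g) ≡ count (λ e → c e ≟ᵐ nothing) (tabulate g)
free≡count zero    g c = refl
free≡count (suc M) g c with c (g zero) ≟ᵐ nothing
... | yes _ = cong suc (free≡count M (g ∘ suc) c)
... | no _  = free≡count M (g ∘ suc) c

free+bound≤ : ∀ {M} (c : Clause (Fin M)) {es} → Unique es → (∀ {e} → e ∈ es → c e ≢ nothing) → free c + length es ≤ M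
free+bound≤ {M} c {es} ues bound = begin
  free c + length es                                          ≡⟨ cong (_+ length es) (free≡count M id c) ⟩
  length frees + length es                                    ≡⟨ length-++ frees ⟨
  length (frees ++ es)                                        ≤⟨ unique⇒length≤ (Unique.++⁺ (Unique.filter⁺ free? (Unique.allFin⁺ M)) ues
                                                                   (λ (e∈ , e∈es) → bound e∈es (proj₂ (∈-filter⁻ free? {xs = allFin M} e∈)))) ⟩
  M                                                           ∎
  where
  open ≤-Reasoning
  free? = λ e → c e ≟ᵐ nothing
  frees = filter free? (allFin M)

module _ {N : ℕ} where

  private
    _∈?_ = member? (_≟ᶠ_ {N})

  -- The variable of the pair a < b says whether a ⟶ b; variables of other pairs are unused.
  random : (Fin (N * N) → Bool) → Tournament N
  random σ = record
    { _⟶_ = λ u v → (u <ᶠ v × σ (combine u v) ≡ true) ⊎ (v <ᶠ u × σ (combine v u) ≡ false)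
    ; loopless = λ { u (inj₁ (u<u , _)) → <-irrefl refl u<u ; u (inj₂ (u<u , _)) → <-irrefl refl u<u }
    ; exactlyOne = one
    }
    where
    _⟶_ : Fin N → Fin N → Set
    u ⟶ v = (u <ᶠ v × σ (combine u v) ≡ true) ⊎ (v <ᶠ u × σ (combine v u) ≡ false)
    both : ∀ {b : Bool} → b ≡ true → b ≢ false
    both refl ()
    one : ∀ {u v} → u ≢ v → ((u ⟶ v) × ¬ (v ⟶ u)) ⊎ (¬ (u ⟶ v) × (v ⟶ u))
    one {u} {v} u≢v with <ᶠ-cmp u v
    ... | tri≈ _ u≡v _ = contradiction u≡v u≢v
    ... | tri< u<v _ v≮u with σ (combine u v)
    ...   | true  = inj₁ (inj₁ (u<v , refl) , λ { (inj₁ (v<u , _)) → v≮u v<u ; (inj₂ (_ , ())) })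
    ...   | false = inj₂ ((λ { (inj₁ (_ , ())) ; (inj₂ (v<u , _)) → v≮u v<u }) , inj₂ (u<v , refl))
    one {u} {v} u≢v | tri> u≮v _ v<u with σ (combine v u)
    ...   | true  = inj₂ ((λ { (inj₁ (u<v , _)) → u≮v u<v ; (inj₂ (_ , ())) }) , inj₁ (v<u , refl))
    ...   | false = inj₁ (inj₂ (v<u , refl) , λ { (inj₁ (_ , ())) ; (inj₂ (u<v , _)) → u≮v u<v })

  orderClause′ : List (Fin N) → Fin N × Fin N → Maybe Bool
  orderClause′ [] _ = nothing
  orderClause′ (x ∷ xs) (a , b) with a <ᶠ? b ×-dec a ≟ᶠ x ×-dec b ∈? xs | a <ᶠ? b ×-dec b ≟ᶠ x ×-dec a ∈? xs
  ... | yes _ | _     = just true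
  ... | no _  | yes _ = just false
  ... | no _  | no _  = orderClause′ xs (a , b)

  -- The partial assignment saying that u is an ordered list of the tournament.
  orderClause : List (Fin N) → Clause (Fin (N * N))
  orderClause u e = orderClause′ u (remQuot N e)

  ordered⇒¬violated : ∀ σ {u} → AllPairs (Tournament._⟶_ (random σ)) u →
    ∀ a b → orderClause′ u (a , b) ≢ just (not (σ (combine a b)))
  ordered⇒¬violated σ {[]} _ a b ()
  ordered⇒¬violated σ {x ∷ xs} (x⟶xs ∷ xs⟶) a b eq
    with a <ᶠ? b ×-dec a ≟ᶠ x ×-dec b ∈? xs | a <ᶠ? b ×-dec b ≟ᶠ x ×-dec a ∈? xs
  ... | no _ | no _ = ordered⇒¬violated σ xs⟶ a b eq
  ... | yes (a<b , refl , b∈xs) | _ with All.lookup x⟶xs b∈xs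
  ...   | inj₁ (_ , σ≡true) rewrite σ≡true with () ← eq
  ...   | inj₂ (b<a , _) = <-asym a<b b<a
  ordered⇒¬violated σ {x ∷ xs} (x⟶xs ∷ xs⟶) a b eq | no _ | yes (a<b , refl , a∈xs) with All.lookup x⟶xs a∈xs
  ...   | inj₁ (b<a , _) = <-asym a<b b<a
  ...   | inj₂ (_ , σ≡false) rewrite σ≡false with () ← eq

  pair : Fin N → Fin N → Fin (N * N)
  pair x y with x <ᶠ? y
  ... | yes _ = combine x y
  ... | no _  = combine y x

  pairs : List (Fin N) → List (Fin (N * N))
  pairs []       = []
  pairs (x ∷ xs) = map (pair x) xs ++ pairs xs

  pair-injective : ∀ x {y z} → pair x y ≡ pair x z → y ≡ z
  pair-injective x {y} {z} eq with x <ᶠ? y | x <ᶠ? z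
  ... | yes _ | yes _ = proj₂ (combine-injective x y x z eq)
  ... | yes x<y | no _ = let (x≡z , y≡x) = combine-injective x y z x eq in trans y≡x x≡z
  ... | no _ | yes _ = let (y≡x , x≡z) = combine-injective y x x z eq in trans y≡x x≡z
  ... | no _ | no _ = proj₁ (combine-injective y x z x eq)

  pair-ends : ∀ x y → let (a , b) = remQuot N (pair x y) in (a ≡ x × b ≡ y) ⊎ (a ≡ y × b ≡ x)
  pair-ends x y with x <ᶠ? y
  ... | yes _ = inj₁ (cong proj₁ (remQuot-combine x y) , cong proj₂ (remQuot-combine x y))
  ... | no _  = inj₂ (cong proj₁ (remQuot-combine y x) , cong proj₂ (remQuot-combine y x))

  pairs-ends : ∀ xs {e} → e ∈ pairs xs → let (a , b) = remQuot {N} N e in a ∈ xs × b ∈ xs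
  pairs-ends (x ∷ xs) {e} e∈ with ∈-++⁻ (map (pair x) xs) e∈
  ... | inj₂ e∈pairs = let (a∈ , b∈) = pairs-ends xs e∈pairs in there a∈ , there b∈
  ... | inj₁ e∈map with ∈-map⁻ (pair x) e∈map
  ...   | (y , y∈xs , refl) with pair-ends x y
  ...     | inj₁ (a≡x , b≡y) = here a≡x , there (subst (_∈ xs) (sym b≡y) y∈xs)
  ...     | inj₂ (a≡y , b≡x) = there (subst (_∈ xs) (sym a≡y) y∈xs) , here b≡x

  pairs-unique : ∀ {xs} → Unique xs → Unique (pairs xs)
  pairs-unique [] = []
  pairs-unique {x ∷ xs} (x≢xs ∷ uxs) =
    Unique.++⁺ (Unique.map⁺ (pair-injective x) uxs) (pairs-unique uxs) apart
    where
    apart : ∀ {e} → e ∈ map (pair x) xs × e ∈ pairs xs → ⊥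
    apart (e∈map , e∈pairs) with ∈-map⁻ (pair x) e∈map
    ... | (y , y∈xs , refl) with pair-ends x y | pairs-ends xs e∈pairs
    ...   | inj₁ (a≡x , _) | (a∈xs , _) = All.lookup x≢xs a∈xs (sym a≡x)
    ...   | inj₂ (_ , b≡x) | (_ , b∈xs) = All.lookup x≢xs b∈xs (sym b≡x)

  later-bound : ∀ x xs {a b} → orderClause′ xs (a , b) ≢ nothing → orderClause′ (x ∷ xs) (a , b) ≢ nothing
  later-bound x xs {a} {b} bound eq
    with a <ᶠ? b ×-dec a ≟ᶠ x ×-dec b ∈? xs | a <ᶠ? b ×-dec b ≟ᶠ x ×-dec a ∈? xs
  later-bound x xs bound () | yes _ | _
  later-bound x xs bound () | no _ | yes _
  ... | no _ | no _ = bound eq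

  head-bound : ∀ x xs {a b} → a <ᶠ b → (a ≡ x × b ∈ xs) ⊎ (b ≡ x × a ∈ xs) → orderClause′ (x ∷ xs) (a , b) ≢ nothing
  head-bound x xs {a} {b} a<b ends eq
    with a <ᶠ? b ×-dec a ≟ᶠ x ×-dec b ∈? xs | a <ᶠ? b ×-dec b ≟ᶠ x ×-dec a ∈? xs
  head-bound x xs a<b ends () | yes _ | _
  head-bound x xs a<b ends () | no _ | yes _
  ... | no ¬1 | no ¬2 = [ (λ e → ¬1 (a<b , e)) , (λ e → ¬2 (a<b , e)) ]′ ends

  pairs-bound : ∀ {xs} → Unique xs → ∀ {e} → e ∈ pairs xs → orderClause xs e ≢ nothing
  pairs-bound {x ∷ xs} (x≢xs ∷ uxs) {e} e∈ with ∈-++⁻ (map (pair x) xs) e∈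
  ... | inj₂ e∈pairs = later-bound x xs (pairs-bound uxs e∈pairs)
  ... | inj₁ e∈map with ∈-map⁻ (pair x) e∈map
  ...   | (y , y∈xs , refl) with x <ᶠ? y
  ...     | yes x<y = subst (λ p → orderClause′ (x ∷ xs) p ≢ nothing) (sym (remQuot-combine x y))
                        (head-bound x xs x<y (inj₁ (refl , y∈xs)))
  ...     | no x≮y  = subst (λ p → orderClause′ (x ∷ xs) p ≢ nothing) (sym (remQuot-combine y x))
                        (head-bound x xs (≤∧≢⇒< (≮⇒≥ x≮y) (λ y≡x → All.lookup x≢xs y∈xs (sym (toℕ-injective y≡x))))
                          (inj₂ (refl , y∈xs)))

  lists : ℕ → List (List (Fin N))
  lists zero    = [] ∷ []
  lists (suc t) = cartesianProductWith {C = List (Fin N)} _∷_ (allFin N) (lists t)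

  ∈-lists : ∀ u → u ∈ lists (length u)
  ∈-lists []      = here refl
  ∈-lists (x ∷ u) = ∈-cartesianProductWith⁺ _∷_ (∈-allFin x) (∈-lists u)

  length-lists : ∀ t → length (lists t) ≡ N ^ t
  length-lists zero    = refl
  length-lists (suc t) = trans (length-× (allFin N)) (cong₂ _*_ (length-tabulate {n = N} id) (length-lists t))
    where
    length-× : ∀ xs → length (cartesianProductWith {C = List (Fin N)} _∷_ xs (lists t)) ≡ length xs * length (lists t)
    length-× []       = refl
    length-× (x ∷ xs) = trans (length-++ (map (x ∷_) (lists t)))
      (cong₂ _+_ (length-map (x ∷_) (lists t)) (length-× xs))

triangular : ℕ → ℕ
triangular zero    = 0
triangular (suc t) = t + triangular t

length-pairs : ∀ {N} (xs : List (Fin N)) → length (pairs xs) ≡ triangular (length xs)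
length-pairs []       = refl
length-pairs (x ∷ xs) = trans (length-++ (map (pair x) xs)) (cong₂ _+_ (length-map (pair x) xs) (length-pairs xs))

-- Erdős and Moser's bound; the inequality says that the expected number of ordered lists of
-- length t in a random tournament is less than 1.
no-ordered-list : ∀ N t → N ^ t < 2 ^ triangular t →
                  Σ (Tournament N) λ T → ∀ {u} → AllPairs (Tournament._⟶_ T) u → length u ≢ t
no-ordered-list N t N^t< = random σ , none
  where
  open ≤-Reasoning
  unique? = uniq? (_≟ᶠ_ {N})
  right-length? = λ (u : List (Fin N)) → length u ≟ t
  us : List (List (Fin N))
  us = filter right-length? (filter unique? (lists t))
  clause-weight : ∀ {u} → u ∈ us → 2 ^ triangular t * 2 ^ free (orderClause u) ≤ 2 ^ (N * N)
  clause-weight {u} u∈ = begin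
    2 ^ triangular t * 2 ^ free (orderClause u)       ≡⟨ ^-distribˡ-+-* 2 (triangular t) _ ⟨
    2 ^ (triangular t + free (orderClause u))         ≡⟨ cong (2 ^_) (+-comm (triangular t) _) ⟩
    2 ^ (free (orderClause u) + triangular t)         ≡⟨ cong (λ l → 2 ^ (free (orderClause u) + triangular l)) len ⟨
    2 ^ (free (orderClause u) + triangular (length u))  ≡⟨ cong (λ l → 2 ^ (free (orderClause u) + l)) (length-pairs u) ⟨
    2 ^ (free (orderClause u) + length (pairs u))     ≤⟨ ^-monoʳ-≤ 2 (free+bound≤ (orderClause u) (pairs-unique u-unique) (pairs-bound u-unique)) ⟩
    2 ^ (N * N)                                       ∎
    where
    len = proj₂ (∈-filter⁻ right-length? {xs = filter unique? (lists t)} u∈)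
    u-unique = proj₂ (∈-filter⁻ unique? {xs = lists t} (proj₁ (∈-filter⁻ right-length? u∈)))
  weight-map : ∀ vs → weight (map orderClause vs) ≡ ∑ (λ u → 2 ^ free (orderClause u)) vs
  weight-map []       = refl
  weight-map (v ∷ vs) = cong (2 ^ free (orderClause v) +_) (weight-map vs)
  total : weight (map orderClause us) < 2 ^ (N * N)
  total = *-cancelˡ-< (2 ^ triangular t) _ _ (begin-strict
    2 ^ triangular t * weight (map orderClause us)                     ≡⟨ cong (2 ^ triangular t *_) (weight-map us) ⟩
    2 ^ triangular t * ∑ (λ u → 2 ^ free (orderClause u)) us           ≤⟨ ∑≤length* (2 ^ triangular t) us clause-weight ⟩
    length us * 2 ^ (N * N)                                            ≤⟨ *-monoˡ-≤ (2 ^ (N * N)) (≤-trans (length-filter right-length? (filter unique? (lists t))) (length-filter unique? (lists t))) ⟩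
    length (lists {N} t) * 2 ^ (N * N)                                 ≡⟨ cong (_* 2 ^ (N * N)) (length-lists t) ⟩
    N ^ t * 2 ^ (N * N)                                                <⟨ *-monoˡ-< (2 ^ (N * N)) {{m^n≢0 2 (N * N)}} N^t< ⟩
    2 ^ triangular t * 2 ^ (N * N)                                     ∎)
  solution = satisfiable (N * N) (map orderClause us) total
  σ = proj₁ solution
  none : ∀ {u} → AllPairs (Tournament._⟶_ (random σ)) u → length u ≢ t
  none {u} u⟶ len = impossible (proj₂ solution (orderClause u) (∈-map⁺ orderClause u∈us))
    where
    u∈us : u ∈ us
    u∈us = ∈-filter⁺ right-length? (∈-filter⁺ unique? (subst (λ l → u ∈ lists l) len (∈-lists u))
             (ordered⇒unique (random σ) u⟶)) len
    impossible : ∃[ e ] orderClause u e ≡ just (not (σ e)) → ⊥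
    impossible (e , violated) = let (a , b) = remQuot {N} N e in
      ordered⇒¬violated σ u⟶ a b (trans violated (cong (λ e → just (not (σ e))) (sym (combine-remQuot {N} N e))))

-- Asymptotics

-- The vertices v₁ , v₃ , v₅ , … of the path are ordered.
unordered⇒path-free : ∀ {n} (T : Tournament n) t k → 2 * t ≤ k →
                      (∀ {u} → AllPairs (Tournament._⟶_ T) u → length u ≢ t) → (P k -Free) T
unordered⇒path-free T t k 2t≤k unordered (m , f , iso) = unordered
  (AllPairs.tabulate⁺-< {f = Injection.to f ∘ vertex} forward) (length-tabulate _)
  where
  open _≅_ iso
  odd : Fin t → Fin k
  odd i = fromℕ< (<-≤-trans (*-monoʳ-< 2 (toℕ<n i)) 2t≤k)
  toℕ-odd : ∀ i → toℕ (odd i) ≡ 2 * toℕ i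
  toℕ-odd i = toℕ-fromℕ< _
  vertex : Fin t → Fin m
  vertex i = proj₁ (Bijection.strictlySurjective bijection (odd i))
  to-vertex : ∀ i → Bijection.to bijection (vertex i) ≡ odd i
  to-vertex i = proj₂ (Bijection.strictlySurjective bijection (odd i))
  forward : ∀ {i j} → toℕ i < toℕ j → _
  forward {i} {j} i<j = Equivalence.from (edges (vertex i) (vertex j))
    (subst₂ (Tournament._⟶_ (P k)) (sym (to-vertex i)) (sym (to-vertex j))
      (inj₂ (≤-trans (n≤1+n _) far , λ eq → <⇒≢ far (sym eq))))
    where
    far : 2 + toℕ (odd i) ≤ toℕ (odd j)
    far = subst₂ (λ a b → 2 + a ≤ b) (sym (toℕ-odd i)) (sym (toℕ-odd j))
      (≤-trans (≤-reflexive (sym (*-suc 2 (toℕ i)))) (*-monoʳ-≤ 2 i<j))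

unordered⇒transitive-< : ∀ {n} (T : Tournament n) t → (∀ {u} → AllPairs (Tournament._⟶_ T) u → length u ≢ t) →
                         ∀ {m} (f : Fin m ↣ Fin n) → Transitive (T [ f ]) → m < t
unordered⇒transitive-< T t unordered {m} f tr with t ≤? m
... | no t≰m = ≰⇒> t≰m
... | yes t≤m = let (u , u⟶ , len) = sub-transitive⇒ordered T f tr in
  contradiction (trans (length-take t u) (m≤n⇒m⊓n≡m (≤-trans t≤m (≤-reflexive (sym len)))))
                (unordered (AllPairs.take⁺ t u⟶))

2*triangular+n≡n*n : ∀ n → 2 * triangular n + n ≡ n * n
2*triangular+n≡n*n zero    = refl
2*triangular+n≡n*n (suc n) = begin
  2 * (n + triangular n) + suc n            ≡⟨ lemma n (triangular n) ⟩
  1 + 2 * n + (2 * triangular n + n)        ≡⟨ cong (1 + 2 * n +_) (2*triangular+n≡n*n n) ⟩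
  1 + 2 * n + n * n                         ≡⟨ lemma′ n ⟩
  suc n * suc n                             ∎
  where
  open ≡-Reasoning
  lemma : ∀ n t → 2 * (n + t) + (1 + n) ≡ 1 + 2 * n + (2 * t + n)
  lemma = solve-∀
  lemma′ : ∀ n → 1 + 2 * n + n * n ≡ (1 + n) * (1 + n)
  lemma′ = solve-∀

few-lists : ∀ h → let t = 2 * h + 2 in (2 ^ h) ^ t < 2 ^ triangular t
few-lists h = subst (_< 2 ^ triangular t) (sym (^-*-assoc 2 h t)) (^-monoʳ-< 2 (s≤s (s≤s z≤n)) {h * t} {triangular t}
  (*-cancelˡ-< 2 (h * t) (triangular t) (+-cancelʳ-< t (2 * (h * t)) (2 * triangular t) (begin-strict
    2 * (h * t) + t              <⟨ +-monoʳ-< (2 * (h * t)) (m<m+n t (≤-trans (s≤s z≤n) (m≤n+m 2 (2 * h)))) ⟩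
    2 * (h * t) + (t + t)        ≡⟨ lemma h t ⟩
    t * t                        ≡⟨ 2*triangular+n≡n*n t ⟨
    2 * triangular t + t         ∎))))
  where
  open ≤-Reasoning
  t = 2 * h + 2
  lemma : ∀ h t → 2 * (h * t) + (t + t) ≡ (2 * h + 2) * t
  lemma = solve-∀

^-cancelʳ-≤ : ∀ m n → 2 ^ m ≤ 2 ^ n → m ≤ n
^-cancelʳ-≤ m n 2^m≤2^n = ≮⇒≥ (λ n<m → <⇒≱ (^-monoʳ-< 2 (s≤s (s≤s z≤n)) n<m) 2^m≤2^n)

exponent-bound : ∀ {k} h u → 2 * (2 * h + 2) ≤ k → 2 * h + 2 ≤ 2 ^ u →
                 ∀ {p} → 0ℚ ℚ.< p → EHCoefficient (P k) p → h * ∣ ↥ p ∣ ≤ u * ↧ₙ p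
exponent-bound {k} h u 2t≤k t≤2^u {p} 0<p (x , (_ , large) , p<x) =
  let t = 2 * h + 2
      (T , unordered) = no-ordered-list (2 ^ h) t (few-lists h)
      (m , f , tr , power) = large (2 ^ h) {{m^n≢0 2 h}} T (unordered⇒path-free T t k 2t≤k unordered)
      m≤2^u = ≤-trans (<⇒≤ (unordered⇒transitive-< T t unordered f tr)) t≤2^u
  in ^-cancelʳ-≤ _ _ (begin
    2 ^ (h * ∣ ↥ p ∣)       ≡⟨ ^-*-assoc 2 h ∣ ↥ p ∣ ⟨
    (2 ^ h) ^ ∣ ↥ p ∣       ≤⟨ power p (ℚ.<⇒≤ 0<p) (λ x<p → ℝ.disjoint x (p<x , x<p)) ⟩
    m ^ ↧ₙ p                ≤⟨ ^-monoˡ-≤ (↧ₙ p) m≤2^u ⟩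
    (2 ^ u) ^ ↧ₙ p          ≡⟨ ^-*-assoc 2 u (↧ₙ p) ⟩
    2 ^ (u * ↧ₙ p)          ∎)
  where open ≤-Reasoning

^-distribʳ-* : ∀ m n o → (m * n) ^ o ≡ m ^ o * n ^ o
^-distribʳ-* m n zero    = refl
^-distribʳ-* m n (suc o) = trans (cong (m * n *_) (^-distribʳ-* m n o)) (lemma m n (m ^ o) (n ^ o))
  where
  lemma : ∀ a b c d → a * b * (c * d) ≡ a * c * (b * d)
  lemma = solve-∀

square-cancel-< : ∀ m n → m * m < n * n → m < n
square-cancel-< m n m²<n² = ≰⇒> (λ n≤m → <⇒≱ m²<n² (*-mono-≤ n≤m n≤m))

log-bound : ℕ → ℕ
log-bound l = 16 * ((2 + l) * (2 + l))

polylog-bound : ∀ b → ∃[ l₀ ] ∀ l → l₀ ≤ l → log-bound l ^ b < 2 ^ l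
polylog-bound b = 4 * (C * C) , bound
  where
  g = suc (4 * b)
  C = (16 * (g * g)) ^ b
  bound : ∀ l → 4 * (C * C) ≤ l → log-bound l ^ b < 2 ^ l
  bound l l₀≤l = ≤-<-trans log-bound≤ (square-cancel-< (C * y) (2 ^ l) (begin-strict
    (C * y) * (C * y)                ≡⟨ lemma₁ C y ⟩
    C * C * (y * y)                  ≤⟨ *-monoʳ-≤ (C * C) y²≤ ⟩
    C * C * (4 * 2 ^ l)              ≡⟨ lemma₂ (C * C) (2 ^ l) 4 ⟩
    4 * (C * C) * 2 ^ l              <⟨ *-monoˡ-< (2 ^ l) {{m^n≢0 2 l}} (<-≤-trans (n<2^n (4 * (C * C))) (^-monoʳ-≤ 2 l₀≤l)) ⟩
    2 ^ l * 2 ^ l                    ∎))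
    where
    open ≤-Reasoning
    q = (2 + l) / g
    y = 2 ^ (2 * (b * q))
    lemma₁ : ∀ a b → (a * b) * (a * b) ≡ a * a * (b * b)
    lemma₁ = solve-∀
    lemma₂ : ∀ c e n → c * (n * e) ≡ n * c * e
    lemma₂ = solve-∀
    lemma₃ : ∀ b q → 2 * (b * q) + 2 * (b * q) ≡ q * (4 * b)
    lemma₃ = solve-∀
    lemma₄ : ∀ n g e → n * ((g * e) * (g * e)) ≡ n * (g * g) * (e * e)
    lemma₄ = solve-∀
    lemma₅ : ∀ b q → (q + q) * b ≡ 2 * (b * q)
    lemma₅ = solve-∀
    y²≤ : y * y ≤ 4 * 2 ^ l
    y²≤ = begin
      y * y                                     ≡⟨ ^-distribˡ-+-* 2 (2 * (b * q)) (2 * (b * q)) ⟨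
      2 ^ (2 * (b * q) + 2 * (b * q))           ≡⟨ cong (2 ^_) (lemma₃ b q) ⟩
      2 ^ (q * (4 * b))                         ≤⟨ ^-monoʳ-≤ 2 (≤-trans (*-monoʳ-≤ q (n≤1+n (4 * b))) (m/n*n≤m (2 + l) g)) ⟩
      2 ^ (2 + l)                               ≡⟨ ^-distribˡ-+-* 2 2 l ⟩
      4 * 2 ^ l                                 ∎
    2+l≤ : 2 + l ≤ g * 2 ^ q
    2+l≤ = begin
      2 + l                         ≡⟨ m≡m%n+[m/n]*n (2 + l) g ⟩
      (2 + l) % g + q * g           ≤⟨ +-monoˡ-≤ (q * g) (<⇒≤ (m%n<n (2 + l) g)) ⟩
      suc q * g                     ≤⟨ *-monoˡ-≤ g (n<2^n q) ⟩
      2 ^ q * g                     ≡⟨ *-comm (2 ^ q) g ⟩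
      g * 2 ^ q                     ∎
    log-bound≤ : log-bound l ^ b ≤ C * y
    log-bound≤ = begin
      (16 * ((2 + l) * (2 + l))) ^ b                    ≤⟨ ^-monoˡ-≤ b (*-monoʳ-≤ 16 (*-mono-≤ 2+l≤ 2+l≤)) ⟩
      (16 * ((g * 2 ^ q) * (g * 2 ^ q))) ^ b            ≡⟨ cong (_^ b) (lemma₄ 16 g (2 ^ q)) ⟩
      (16 * (g * g) * (2 ^ q * 2 ^ q)) ^ b              ≡⟨ ^-distribʳ-* (16 * (g * g)) (2 ^ q * 2 ^ q) b ⟩
      C * (2 ^ q * 2 ^ q) ^ b                           ≡⟨ cong (λ e → C * e ^ b) (^-distribˡ-+-* 2 q q) ⟨
      C * (2 ^ (q + q)) ^ b                             ≡⟨ cong (C *_) (^-*-assoc 2 (q + q) b) ⟩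
      C * 2 ^ ((q + q) * b)                             ≡⟨ cong (λ e → C * 2 ^ e) (lemma₅ b q) ⟩
      C * y                                             ∎

record Scale (k l : ℕ) : Set where
  field
    2^l≤k   : 2 ^ l ≤ k
    k<2^1+l : k < 2 ^ suc l

  scale-nonZero : NonZero k
  scale-nonZero = >-nonZero (≤-trans (m^n>0 2 l) 2^l≤k)

scale : ∀ k → 2 ≤ k → ∃[ l ] Scale k l
scale k 2≤k =
  let (d , ≤k , k<) = bracket 2 k k 2≤k (≤-trans (n<2^n k) (m≤m*n (2 ^ k) 2))
  in suc d , record
    { 2^l≤k   = ≤-trans (≤-reflexive (*-comm 2 (2 ^ d))) ≤k
    ; k<2^1+l = ≤-trans k< (≤-reflexive (*-comm (2 ^ suc d) 2)) }

scale-≥ : ∀ {k l} l₀ → Scale k l → 2 ^ l₀ ≤ k → l₀ ≤ l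
scale-≥ l₀ s 2^l₀≤k = ≮⇒≥ (λ l<l₀ → <⇒≱ (Scale.k<2^1+l s) (≤-trans (^-monoʳ-≤ 2 l<l₀) 2^l₀≤k))

power-bound : ∀ N k h u c d b .{{_ : NonZero k}} .{{_ : NonZero h}} .{{_ : NonZero d}} .{{_ : NonZero b}} →
              h * c ≤ u * d → k ≤ N * h → (N * u) ^ b < k → c ^ b * k ^ pred b < d ^ b
power-bound N k h u c d b hc≤ud k≤Nh Nu^b<k = *-cancelˡ-< (k * h ^ b) _ _ (begin-strict
  k * h ^ b * (c ^ b * k ^ pred b)      ≡⟨ lemma₁ k (h ^ b) (c ^ b) (k ^ pred b) ⟩
  h ^ b * c ^ b * (k * k ^ pred b)      ≡⟨ cong₂ _*_ (sym (^-distribʳ-* h c b)) (cong (k ^_) (suc-pred b)) ⟩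
  (h * c) ^ b * k ^ b                   ≤⟨ *-mono-≤ (^-monoˡ-≤ b hc≤ud) (^-monoˡ-≤ b k≤Nh) ⟩
  (u * d) ^ b * (N * h) ^ b             ≡⟨ ^-distribʳ-* (u * d) (N * h) b ⟨
  (u * d * (N * h)) ^ b                 ≡⟨ cong (_^ b) (lemma₂ u d h N) ⟩
  (N * u * (h * d)) ^ b                 ≡⟨ ^-distribʳ-* (N * u) (h * d) b ⟩
  (N * u) ^ b * (h * d) ^ b             <⟨ *-monoˡ-< ((h * d) ^ b) {{m^n≢0 (h * d) b {{m*n≢0 h d}}}} Nu^b<k ⟩
  k * (h * d) ^ b                       ≡⟨ cong (k *_) (^-distribʳ-* h d b) ⟩
  k * (h ^ b * d ^ b)                   ≡⟨ *-assoc k (h ^ b) (d ^ b) ⟨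
  k * h ^ b * d ^ b                     ∎)
  where
  open ≤-Reasoning
  lemma₁ : ∀ k a b e → k * a * (b * e) ≡ a * b * (k * e)
  lemma₁ = solve-∀
  lemma₂ : ∀ u d h n → u * d * (n * h) ≡ n * u * (h * d)
  lemma₂ = solve-∀

quarter : ∀ k → 8 ≤ k → ∃[ h ] NonZero h × 2 * (2 * h + 2) ≤ k × k ≤ 16 * h
quarter k 8≤k = go (k / 4) (/-monoˡ-≤ 4 8≤k) (m/n*n≤m k 4) (begin
  k                        ≡⟨ m≡m%n+[m/n]*n k 4 ⟩
  k % 4 + k / 4 * 4        ≤⟨ +-monoˡ-≤ (k / 4 * 4) (<⇒≤ (m%n<n k 4)) ⟩
  4 + k / 4 * 4            ∎)
  where
  open ≤-Reasoning
  go : ∀ q → 2 ≤ q → q * 4 ≤ k → k ≤ 4 + q * 4 → ∃[ h ] NonZero h × 2 * (2 * h + 2) ≤ k × k ≤ 16 * h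
  go (suc h) (s≤s 1≤h) ≤k k≤ = h , >-nonZero 1≤h , ≤-trans (≤-reflexive (lemma h)) ≤k , (begin
    k                             ≤⟨ k≤ ⟩
    4 + suc h * 4                 ≡⟨ lemma′ h ⟩
    8 * 1 + 4 * h                 ≤⟨ +-monoˡ-≤ (4 * h) (*-monoʳ-≤ 8 1≤h) ⟩
    8 * h + 4 * h                 ≤⟨ m≤m+n _ (4 * h) ⟩
    8 * h + 4 * h + 4 * h         ≡⟨ lemma″ h ⟩
    16 * h                        ∎)
    where
    lemma : ∀ h → 2 * (2 * h + 2) ≡ (1 + h) * 4
    lemma = solve-∀
    lemma′ : ∀ h → 4 + (1 + h) * 4 ≡ 8 * 1 + 4 * h
    lemma′ = solve-∀
    lemma″ : ∀ h → 8 * h + 4 * h + 4 * h ≡ 16 * h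
    lemma″ = solve-∀

module _ {k l : ℕ} (s : Scale k l) (b : ℕ) (k-large : log-bound l ^ b < 2 ^ l) where
  open Scale s

  private instance
    k≢0 : NonZero k
    k≢0 = scale-nonZero

  exponent≤ : suc (exponent k (2 + l)) ≤ k * log-bound l
  exponent≤ = begin
    suc (exponent k r)                                                    ≡⟨ lemma₁ k r ⟩
    3 * (1 * 1) + 4 * (r * 1) + (5 * (k * (r * 1)) + 3 * (k * (r * r)))   ≤⟨ +-mono-≤
        (+-mono-≤ (*-monoʳ-≤ 3 (scale-up 1≤k (*-mono-≤ 1≤r 1≤r))) (*-monoʳ-≤ 4 (scale-up 1≤k (*-monoʳ-≤ r 1≤r))))
        (+-monoˡ-≤ (3 * (k * (r * r))) (*-monoʳ-≤ 5 (*-monoʳ-≤ k (*-monoʳ-≤ r 1≤r)))) ⟩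
    3 * K + 4 * K + (5 * K + 3 * K)                                       ≤⟨ m≤m+n _ K ⟩
    3 * K + 4 * K + (5 * K + 3 * K) + K                                   ≡⟨ lemma₂ k (r * r) ⟩
    k * (16 * (r * r))                                                    ∎
    where
    open ≤-Reasoning
    r = 2 + l
    K = k * (r * r)
    1≤k : 1 ≤ k
    1≤k = >-nonZero⁻¹ k
    1≤r : 1 ≤ r
    1≤r = s≤s z≤n
    scale-up : ∀ {m n} → 1 ≤ k → m ≤ n → m ≤ k * n
    scale-up 1≤k m≤n = ≤-trans m≤n (m≤n*m _ k)
    lemma₁ : ∀ k r → 1 + (r * (3 + k * (5 + 3 * r)) + (2 + r))
                   ≡ 3 * (1 * 1) + 4 * (r * 1) + (5 * (k * (r * 1)) + 3 * (k * (r * r)))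
    lemma₁ = solve-∀
    lemma₂ : ∀ k e → 3 * (k * e) + 4 * (k * e) + (5 * (k * e) + 3 * (k * e)) + k * e ≡ k * (16 * e)
    lemma₂ = solve-∀

  exponent^b≤ : suc (exponent k (2 + l)) ^ b ≤ k ^ suc b
  exponent^b≤ = begin
    suc (exponent k (2 + l)) ^ b      ≤⟨ ^-monoˡ-≤ b exponent≤ ⟩
    (k * log-bound l) ^ b             ≡⟨ ^-distribʳ-* k (log-bound l) b ⟩
    k ^ b * log-bound l ^ b           ≤⟨ *-monoʳ-≤ (k ^ b) (≤-trans (<⇒≤ k-large) 2^l≤k) ⟩
    k ^ b * k                         ≡⟨ *-comm (k ^ b) k ⟩
    k ^ suc b                         ∎
    where open ≤-Reasoning

  1/exponent-HasEHExponent : HasEHExponent (P k) (fromℚ (1/suc (exponent k (2 + l))))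
  1/exponent-HasEHExponent = ℚ.<-asym 0<1/suc , λ n T free →
    let (m , f , tr , m≢0 , n≤m^L) = large-transitive T k (2 + l) 2k+2≤ free in
    m , f , tr , λ q 0≤q q≯ → power n m {{m≢0}} n≤m^L q (≤1/suc (exponent k (2 + l)) q 0≤q (ℚ.≮⇒≥ q≯))
    where
    open ≤-Reasoning
    0<1/suc : 0ℚ ℚ.< 1/suc (exponent k (2 + l))
    0<1/suc = <1/suc (exponent k (2 + l)) 0ℚ (s≤s z≤n)
    2k+2≤ : 2 * k + 2 ≤ 2 ^ (2 + l)
    2k+2≤ = ≤-trans (≤-reflexive (trans (+-comm (2 * k) 2) (sym (*-suc 2 k)))) (*-monoʳ-≤ 2 k<2^1+l)
    power : ∀ n m .{{_ : NonZero m}} {L} → n ≤ m ^ L → ∀ q → ∣ ↥ q ∣ * L ≤ ↧ₙ q → n ^ ∣ ↥ q ∣ ≤ m ^ ↧ₙ q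
    power n m {L} n≤m^L q aL≤b = begin
      n ^ ∣ ↥ q ∣              ≤⟨ ^-monoˡ-≤ ∣ ↥ q ∣ n≤m^L ⟩
      (m ^ L) ^ ∣ ↥ q ∣        ≡⟨ ^-*-assoc m L ∣ ↥ q ∣ ⟩
      m ^ (L * ∣ ↥ q ∣)        ≡⟨ cong (m ^_) (*-comm L ∣ ↥ q ∣) ⟩
      m ^ (∣ ↥ q ∣ * L)        ≤⟨ ^-monoʳ-≤ m aL≤b ⟩
      m ^ ↧ₙ q                 ∎

  lower-bound : ∀ {p} → (0ℚ ℚ.< p → ∣ ↥ p ∣ ^ b * k ^ suc b < ↧ₙ p ^ b) → EHCoefficient (P k) p
  lower-bound {p} small = fromℚ (1/suc L) , 1/exponent-HasEHExponent , p<1/L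
    where
    L = exponent k (2 + l)
    p<1/L : p ℚ.< 1/suc L
    p<1/L with 0ℚ ℚ.<? p
    ... | no 0≮p  = ℚ.≤-<-trans (ℚ.≮⇒≥ 0≮p) (<1/suc L 0ℚ (s≤s z≤n))
    ... | yes 0<p = <1/suc L p (≰⇒> λ d≤cL → <⇒≱ (small 0<p) (begin
      ↧ₙ p ^ b                        ≤⟨ ^-monoˡ-≤ b d≤cL ⟩
      (∣ ↥ p ∣ * suc L) ^ b           ≡⟨ ^-distribʳ-* ∣ ↥ p ∣ (suc L) b ⟩
      ∣ ↥ p ∣ ^ b * suc L ^ b         ≤⟨ *-monoʳ-≤ (∣ ↥ p ∣ ^ b) exponent^b≤ ⟩
      ∣ ↥ p ∣ ^ b * k ^ suc b         ∎))
      where open ≤-Reasoning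

  upper-bound : .{{_ : NonZero b}} → 8 ≤ k → ∀ {p} → 0ℚ ℚ.< p → EHCoefficient (P k) p →
                ∣ ↥ p ∣ ^ b * k ^ pred b < ↧ₙ p ^ b
  upper-bound 8≤k {p} 0<p below =
    let (h , h≢0 , 2t≤k , k≤16h) = quarter k 8≤k
        t≤2^u = ≤-trans (m≤n*m (2 * h + 2) 2) (≤-trans 2t≤k (<⇒≤ k<2^1+l))
    in power-bound 16 k h (suc l) ∣ ↥ p ∣ (↧ₙ p) b {{k≢0}} {{h≢0}}
         (exponent-bound h (suc l) 2t≤k t≤2^u 0<p below) k≤16h
         (<-≤-trans (≤-<-trans (^-monoˡ-≤ b (*-monoʳ-≤ 16 (≤-trans (n≤1+n (suc l)) (m≤m*n (2 + l) (2 + l))))) k-large) 2^l≤k)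

eventual-bounds : ∀ s₁ s₂ → s₁ ℚ.< ℚ.- 1ℚ → ℚ.- 1ℚ ℚ.< s₂ → ∃[ K ] ∀ k → K ≤ k →
                  ((k ^ℚ s₁) ⊆ EHCoefficient (P k)) × (EHCoefficient (P k) ⊆ (k ^ℚ s₂))
eventual-bounds s₁ s₂ s₁<-1 -1<s₂ = join (polylog-bound (↧ₙ s₁)) (polylog-bound (↧ₙ s₂))
  where
  join : ∃[ l₁ ] (∀ l → l₁ ≤ l → log-bound l ^ ↧ₙ s₁ < 2 ^ l) →
            ∃[ l₂ ] (∀ l → l₂ ≤ l → log-bound l ^ ↧ₙ s₂ < 2 ^ l) → _
  join (l₁ , large₁) (l₂ , large₂) = 8 + (2 ^ l₁ + 2 ^ l₂) , bounds
    where
    bounds : ∀ k → 8 + (2 ^ l₁ + 2 ^ l₂) ≤ k →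
             ((k ^ℚ s₁) ⊆ EHCoefficient (P k)) × (EHCoefficient (P k) ⊆ (k ^ℚ s₂))
    bounds k K≤k with scale k (≤-trans (≤-trans (s≤s (s≤s z≤n)) (m≤m+n 8 _)) K≤k)
    ... | l , sc = lower , upper
      where
      instance
        k≢0 : NonZero k
        k≢0 = Scale.scale-nonZero sc
      sum≤k : 2 ^ l₁ + 2 ^ l₂ ≤ k
      sum≤k = ≤-trans (m≤n+m _ 8) K≤k
      l₁≤l : l₁ ≤ l
      l₁≤l = scale-≥ l₁ sc (≤-trans (m≤m+n (2 ^ l₁) (2 ^ l₂)) sum≤k)
      l₂≤l : l₂ ≤ l
      l₂≤l = scale-≥ l₂ sc (≤-trans (m≤n+m (2 ^ l₂) (2 ^ l₁)) sum≤k)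
      lower : (k ^ℚ s₁) ⊆ EHCoefficient (P k)
      lower {p} p∈ = lower-bound sc (↧ₙ s₁) (large₁ l l₁≤l) (λ 0<p → ∈-^ℚ⁻ k s₁ p s₁<-1 0<p p∈)
      upper : EHCoefficient (P k) ⊆ (k ^ℚ s₂)
      upper {p} below with 0ℚ ℚ.<? p
      ... | no 0≮p  = inj₁ (ℚ.≮⇒≥ 0≮p)
      ... | yes 0<p = ∈-^ℚ⁺ k s₂ p -1<s₂ 0<p
        (upper-bound sc (↧ₙ s₂) (large₂ l l₂≤l) (≤-trans (m≤m+n 8 _) K≤k) 0<p below)

theorem3p5 : (λ k → EHCoefficient (P k)) ≈1/k^[1+o[1]]
theorem3p5 δ 0<δ = eventual-bounds (ℚ.- (1ℚ ℚ.+ δ)) (ℚ.- (1ℚ ℚ.- δ))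
  (ℚ.neg-antimono-< (subst (ℚ._< 1ℚ ℚ.+ δ) (ℚ.+-identityʳ 1ℚ) (ℚ.+-monoʳ-< 1ℚ 0<δ)))
  (ℚ.neg-antimono-< (subst (1ℚ ℚ.- δ ℚ.<_) (ℚ.+-identityʳ 1ℚ) (ℚ.+-monoʳ-< 1ℚ (ℚ.neg-antimono-< 0<δ))))
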